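{- Assume that $M,N\colon G\to\mathbb C$ satisfy $\beta(M)\ge\beta(N)$ and $\Psi_M\Psi_{N,N}\ne0$. (i) Assume that $\Psi_N\Psi_{M,N}=\Psi_M\Psi_{N,N}$. Then for all $\alpha\in\mathbb C$ with $\alpha\ne-\frac{\Psi_M}{\Psi_N}$ we have $\beta(M+\alpha N)=\beta(M)$. (ii) Assume that $\Psi_N\Psi_{M,N}\neq\Psi_M\Psi_{N,N}$. Then, for $\alpha\in\mathbb C$, the maximum of $\beta(M+\alpha N)$ occurs for $$\alpha=\alpha_1:=\frac{\overline{\Psi_M}\Psi_{M,N}-\overline{\Psi_N}\Psi_{M,M}}{\overline{\Psi_N}\,\overline{\Psi_{M,N}}-\overline{\Psi_M}\Psi_{N,N}}$$ and is $$\beta(M+\alpha_1N)=\frac{|\Psi_N|^2\Psi_{M,M}+|\Psi_M|^2\Psi_{N,N}-2\mathrm{Re}(\overline{\Psi_M}\Psi_N\Psi_{M,N})}{\Psi_{M,M}\Psi_{N,N}-|\Psi_{M,N}|^2}=\beta(M)+\frac{|\overline{\Psi_M}\Psi_{M,N}-\overline{\Psi_N}\Psi_{M,M}|^2}{\Psi_{M,M}(\Psi_{M,M}\Psi_{N,N}-|\Psi_{M,N}|^2)}.$$ The denominators in these expressions for $\beta(M+\alpha_1N)$ are positive.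
   Context: $G$ is an (indexing) set, $L\colon G\to\mathbb C$ is a function, and $w\colon G\to[0,\infty)$ is a weight function, not identically $0$. For $f\colon G\to\mathbb C$ put $\mathbb E^w_{\pi\in G}f(\pi):=\frac{\sum_{\pi\in G}w(\pi)f(\pi)}{\sum_{\pi\in G}w(\pi)}$. For $M,N\colon G\to\mathbb C$ define $\Psi_M:=\mathbb E^w_{\pi\in G}L(\pi)M(\pi)$, $\Psi_{M,N}:=\mathbb E^w_{\pi\in G}L(\pi)M(\pi)\overline{L(\pi)N(\pi)}$, and $\beta(M):=|\Psi_M|^2/\Psi_{M,M}$ if $\Psi_{M,M}\ne0$, $\beta(M):=0$ if $\Psi_{M,M}=0$. It is assumed that the series $\sum_\pi w(\pi)$ and $\sum_\pi w(\pi)|L(\pi)M(\pi)|^2$ converge for every function $M$ considered (automatic if $G$ is finite). (In (i), the hypotheses force $\Psi_N\neq0$.) -}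

module Defs where

open import Level using (Level; Lift; lift; lower; 0ℓ)
open import Algebra.Bundles using (CommutativeRing)
open import Axiom.ExcludedMiddle using (ExcludedMiddle)
open import Data.Bool.Base using (if_then_else_)
open import Data.List.Base using (List; map; foldr)
open import Data.List.Relation.Binary.Subset.Propositional using (_⊆_)
open import Data.List.Relation.Unary.Unique.Propositional using (Unique)
open import Data.Product.Base using (_×_; _,_; ∃; ∃-syntax)
open import Relation.Binary.Core using (Rel)
open import Relation.Binary.Structures using (IsTotalOrder)
open import Relation.Nullary.Decidable.Core using (Dec; yes; no; does; map′)
open import Relation.Nullary.Negation.Core using (¬_)

-- The real numbers, characterised (classically, up to isomorphism) as a
-- complete ordered field.
record CompleteOrderedField : Set₁ where
  field
    commutativeRing : CommutativeRing 0ℓ 0ℓ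

  open CommutativeRing commutativeRing public

  infix 4 _≤_ _<_
  field
    _≤_          : Rel Carrier 0ℓ
    isTotalOrder : IsTotalOrder _≈_ _≤_
    0≉1          : ¬ 0# ≈ 1#
    inverse      : ∀ x → ¬ x ≈ 0# → ∃[ y ] x * y ≈ 1#
    +-monoˡ-≤    : ∀ {x y} z → x ≤ y → x + z ≤ y + z
    *-nonneg     : ∀ {x y} → 0# ≤ x → 0# ≤ y → 0# ≤ x * y

  UpperBound : (Carrier → Set) → Carrier → Set
  UpperBound P u = ∀ x → P x → x ≤ u

  field
    supremum : ∀ (P : Carrier → Set) → ∃ P → ∃ (UpperBound P) →
               ∃[ s ] (UpperBound P s × (∀ u → UpperBound P u → s ≤ u))

  _<_ : Rel Carrier 0ℓ
  x < y = x ≤ y × ¬ x ≈ y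

-- Excluded middle makes division and infinite summation total operations.
module Analysis (R : CompleteOrderedField) {g : Level} (em : ExcludedMiddle g) where

  open CompleteOrderedField R public using () renaming
    ( Carrier to ℝ ; _≈_ to infix 4 _≈ʳ_ ; _≤_ to infix 4 _≤_ ; _<_ to infix 4 _<_
    ; _+_ to infixl 6 _+ʳ_ ; _-_ to infixl 6 _-ʳ_ ; _*_ to infixl 7 _*ʳ_
    ; -_ to infix 8 -ʳ_ ; 0# to 0ʳ ; 1# to 1ʳ )

  decide : (P : Set) → Dec P
  decide P = map′ lower lift (em {Lift g P})

  -- 0 has reciprocal 0.
  infix 8 _⁻¹
  _⁻¹ : ℝ → ℝ
  x ⁻¹ with decide (x ≈ʳ 0ʳ)
  ... | yes _   = 0ʳ
  ... | no x≉0 with CompleteOrderedField.inverse R x x≉0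
  ...   | y , _ = y

  record ℂ : Set where
    constructor _+i_
    field
      re im : ℝ
  open ℂ public

  infix  4 _≈_
  infixl 6 _+_ _-_
  infixl 7 _*_ _/_
  infix  8 -_ ↑_

  _≈_ : ℂ → ℂ → Set
  z ≈ z′ = re z ≈ʳ re z′ × im z ≈ʳ im z′

  ↑_ : ℝ → ℂ
  ↑ x = x +i 0ʳ

  0ℂ 2ℂ : ℂ
  0ℂ = ↑ 0ʳ
  2ℂ = ↑ (1ʳ +ʳ 1ʳ)

  -_ conj : ℂ → ℂ
  - z    = (-ʳ re z) +i (-ʳ im z)
  conj z = re z +i (-ʳ im z)

  ∣_∣² : ℂ → ℝ
  ∣ z ∣² = re z *ʳ re z +ʳ im z *ʳ im z

  _+_ _-_ _*_ _/_ : ℂ → ℂ → ℂ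
  z + z′ = (re z +ʳ re z′) +i (im z +ʳ im z′)
  z - z′ = (re z -ʳ re z′) +i (im z -ʳ im z′)
  z * z′ = (re z *ʳ re z′ -ʳ im z *ʳ im z′) +i (re z *ʳ im z′ +ʳ im z *ʳ re z′)
  z / z′ = z * (conj z′ * ↑ (∣ z′ ∣² ⁻¹))

  Positive : ℂ → Set
  Positive z = im z ≈ʳ 0ʳ × 0ʳ < re z

  module _ {G : Set g} where

    finiteSum : (G → ℂ) → List G → ℂ
    finiteSum f F = foldr _+_ 0ℂ (map f F)

    -- Unconditional convergence, along the net of finite subsets of G (lists
    -- without repetitions).  Square roots are avoided by squaring |·| < ε.
    HasSum : (G → ℂ) → ℂ → Set g
    HasSum f s = ∀ ε → 0ʳ < ε → ∃[ F ] (∀ F′ → Unique F′ → F ⊆ F′ →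
                   ∣ finiteSum f F′ - s ∣² < ε *ʳ ε)

    Summable : (G → ℂ) → Set g
    Summable f = ∃ (HasSum f)

    -- The sum of f, with the value 0 when f is not summable.
    ∑ : (G → ℂ) → ℂ
    ∑ f with em {Summable f}
    ... | yes (s , _) = s
    ... | no _        = 0ℂ

  module Weighted {G : Set g} (L : G → ℂ) (w : G → ℝ) where

    𝔼 : (G → ℂ) → ℂ
    𝔼 f = ∑ (λ π → ↑ w π * f π) / ∑ (λ π → ↑ w π)

    Ψ : (G → ℂ) → ℂ
    Ψ M = 𝔼 (λ π → L π * M π)

    Ψ₂ : (G → ℂ) → (G → ℂ) → ℂ
    Ψ₂ M N = 𝔼 (λ π → (L π * M π) * conj (L π * N π))

    -- The quotient is a real number, since Ψ₂ M M = 𝔼 |L M|² is real; `re`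
    -- only serves to view it as an element of ℝ.
    β : (G → ℂ) → ℝ
    β M = if does (decide (Ψ₂ M M ≈ 0ℂ)) then 0ʳ else re (↑ ∣ Ψ M ∣² / Ψ₂ M M)

    _+[_]_ : (G → ℂ) → ℂ → (G → ℂ) → (G → ℂ)
    (M +[ α ] N) π = M π + α * N π

module Submission where

-- All series converge absolutely, since the square-summable functions form a
-- vector space (2 |f|² + 2 |h|² dominates |f + h|²) and f h̄ is a combination of
-- squares by polarisation.  Put p = Ψ M, q = Ψ N, A = Ψ₂ M M, B = Ψ₂ N N,
-- C = Ψ₂ M N.  Then β (M + α N) = |p + α q|² / Q α, where
-- Q α = A + ᾱ C + α C̄ + |α|² B ≥ |p + α q|² because variances are nonnegative.
-- At α = - C / B this bound gives |q C - p B|² ≤ B D with D = A B - |C|².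
--
-- If q C = p B, then D ≥ 0 yields |p|² B ≤ |q|² A, and β N ≤ β M is the converse
-- inequality; hence |q|² Q α = B |p + α q|² and the quotient is constant.
-- If q C ≠ p B, then D > 0, and with V the numerator of the claimed maximum
-- V · Q α = D |p + α q|² + |α den - num|², which shows that V / D bounds the
-- quotient and is attained at α₁ = num / den.  Its value at α = 0 is the second
-- formula for the maximum.

-- With x = (1, α), Q α is the Hermitian form of the Gram matrix of L M and L N at x, and p + α q is
-- a linear functional of x. D is the determinant of that matrix and V its adjugate evaluated at (p,
-- q), so V / D is the squared dual norm of the functional: this is the origin of the claimed
-- maximum, and the identity for V · Q α is Cauchy-Schwarz with its defect written as a square.
-- Since `β` takes the value 0 at a vanishing denominator, its quotient formula is usable only where
-- Q α > 0, and the inequality Q α ≥ |p + α q|² is also the source of this positivity. If q C = p B,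
-- the form has rank one and Q α vanishes exactly at α = - p / q, which is why that value is
-- excluded; elsewhere Q α ≥ |p + α q|² > 0. If q C ≠ p B, then D > 0 makes Q α positive for every
-- α, including the zero of p + α q.

open import Defs
open import Algebra.Bundles using (CommutativeRing)
import Algebra.Properties.AbelianGroup as AbelianGroupProperties
import Algebra.Properties.Ring as RingProperties
import Algebra.Properties.Semiring.Mult.TCOptimised as Multiples
import Algebra.Solver.Ring as RingSolver
open import Algebra.Solver.Ring.AlmostCommutativeRing
  using (AlmostCommutativeRing; fromCommutativeRing; _-Raw-AlmostCommutative⟶_)
open import Axiom.ExcludedMiddle using (ExcludedMiddle)
open import Data.Bool.Base using (T; if_then_else_)
open import Data.Integer.Base as ℤ using (ℤ; +_; -[1+_])
import Data.Integer.Properties as ℤ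
open import Data.List.Base using (List; []; _∷_; _++_; deduplicate)
open import Data.List.Membership.Propositional.Properties
  using (∈-∃++; ∈-++⁻; ∈-++⁺ˡ; ∈-++⁺ʳ; ∈-deduplicate⁺)
open import Data.List.Relation.Binary.Subset.Propositional using (_⊆_)
import Data.List.Relation.Unary.All as All
open import Data.List.Relation.Unary.AllPairs.Core using ([]; _∷_)
open import Data.List.Relation.Unary.Any using (here; there)
open import Data.List.Relation.Unary.Unique.Propositional using (Unique)
open import Data.List.Relation.Unary.Unique.DecPropositional.Properties using (deduplicate-!)
open import Data.Maybe.Base using (Maybe; just; nothing)
open import Data.Nat.Base as ℕ using (ℕ; zero; suc)
open import Data.Product.Base using (_×_; _,_; ∃-syntax; proj₁; proj₂)
open import Data.Sum.Base using (inj₁; inj₂)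
open import Level using (Level; 0ℓ)
open import Relation.Binary.Definitions using (DecidableEquality)
open import Relation.Binary.PropositionalEquality.Core as ≡ using (_≡_)
import Relation.Binary.Reasoning.Setoid as SetoidReasoning
open import Relation.Binary.Structures using (IsTotalOrder)
open import Relation.Nullary.Decidable.Core using (Dec; yes; no; does; toWitness; fromWitness; isYes)
open import Relation.Nullary.Negation.Core using (¬_; contradiction)

-- The solver needs coefficients whose equality it can compute, which is not the
-- case in the ring itself; it is therefore run with integer coefficients.
module IntegerCoefficients {c ℓ : Level} (R : CommutativeRing c ℓ) where

  open CommutativeRing R
  open RingProperties ring using (-‿distribˡ-*; -‿distribʳ-*; -0#≈0#; -‿involutive)
  open AbelianGroupProperties +-abelianGroup using (⁻¹-∙-comm)
  open Multiples semiring using (1+×; ×-homo-+; ×1-homo-*) renaming (_×_ to _×′_)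
  open SetoidReasoning setoid

  almostCommutativeRing : AlmostCommutativeRing c ℓ
  almostCommutativeRing = fromCommutativeRing R

  ⟦_⟧ᶻ : ℤ → Carrier
  ⟦ + n ⟧ᶻ      = n ×′ 1#
  ⟦ -[1+ n ] ⟧ᶻ = - (suc n ×′ 1#)

  ⟦⟧ᶻ-cong : ∀ {i j} → i ≡.≡ j → ⟦ i ⟧ᶻ ≈ ⟦ j ⟧ᶻ
  ⟦⟧ᶻ-cong ≡.refl = refl

  -‿homo : ∀ i → ⟦ ℤ.- i ⟧ᶻ ≈ - ⟦ i ⟧ᶻ
  -‿homo (+ zero)  = sym -0#≈0#
  -‿homo (+ suc n) = refl
  -‿homo -[1+ n ]  = sym (-‿involutive _)

  [x+y]-[x+z]≈y-z : ∀ x y z → (x + y) - (x + z) ≈ y - z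
  [x+y]-[x+z]≈y-z x y z = begin
    (x + y) + - (x + z)       ≈⟨ +-cong (+-comm x y) (sym (⁻¹-∙-comm x z)) ⟩
    (y + x) + (- x + - z)     ≈⟨ +-assoc y x _ ⟩
    y + (x + (- x + - z))     ≈⟨ +-congˡ (+-assoc x (- x) (- z)) ⟨
    y + ((x + - x) + - z)     ≈⟨ +-congˡ (+-congʳ (-‿inverseʳ x)) ⟩
    y + (0# + - z)            ≈⟨ +-congˡ (+-identityˡ (- z)) ⟩
    y + - z                   ∎

  ⊖-homo : ∀ m n → ⟦ m ℤ.⊖ n ⟧ᶻ ≈ m ×′ 1# - n ×′ 1#
  ⊖-homo m       zero    = trans (sym (+-identityʳ _)) (+-congˡ (sym -0#≈0#))
  ⊖-homo zero    (suc n) = sym (+-identityˡ _)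
  ⊖-homo (suc m) (suc n) = begin
    ⟦ suc m ℤ.⊖ suc n ⟧ᶻ            ≈⟨ ⟦⟧ᶻ-cong (ℤ.[1+m]⊖[1+n]≡m⊖n m n) ⟩
    ⟦ m ℤ.⊖ n ⟧ᶻ                    ≈⟨ ⊖-homo m n ⟩
    m ×′ 1# - n ×′ 1#                 ≈⟨ [x+y]-[x+z]≈y-z 1# _ _ ⟨
    (1# + m ×′ 1#) - (1# + n ×′ 1#)   ≈⟨ +-cong (1+× m 1#) (-‿cong (1+× n 1#)) ⟨
    suc m ×′ 1# - suc n ×′ 1#         ∎

  +-homo : ∀ i j → ⟦ i ℤ.+ j ⟧ᶻ ≈ ⟦ i ⟧ᶻ + ⟦ j ⟧ᶻ
  +-homo (+ m)    (+ n)    = ×-homo-+ 1# m n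
  +-homo (+ m)    -[1+ n ] = ⊖-homo m (suc n)
  +-homo -[1+ m ] (+ n)    = trans (⊖-homo n (suc m)) (+-comm _ _)
  +-homo -[1+ m ] -[1+ n ] = begin
    ⟦ -[1+ m ] ℤ.+ -[1+ n ] ⟧ᶻ            ≈⟨ ⟦⟧ᶻ-cong (ℤ.neg-distrib-+ (+ suc m) (+ suc n)) ⟨
    ⟦ ℤ.- (+ (suc m ℕ.+ suc n)) ⟧ᶻ        ≈⟨ -‿homo (+ (suc m ℕ.+ suc n)) ⟩
    - ((suc m ℕ.+ suc n) ×′ 1#)            ≈⟨ -‿cong (×-homo-+ 1# (suc m) (suc n)) ⟩
    - (suc m ×′ 1# + suc n ×′ 1#)           ≈⟨ ⁻¹-∙-comm _ _ ⟨
    - (suc m ×′ 1#) + - (suc n ×′ 1#)       ∎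

  pos-*-homo : ∀ m j → ⟦ + m ℤ.* j ⟧ᶻ ≈ ⟦ + m ⟧ᶻ * ⟦ j ⟧ᶻ
  pos-*-homo m (+ n)    = trans (⟦⟧ᶻ-cong (≡.sym (ℤ.pos-* m n))) (×1-homo-* m n)
  pos-*-homo m -[1+ n ] = begin
    ⟦ + m ℤ.* -[1+ n ] ⟧ᶻ         ≈⟨ ⟦⟧ᶻ-cong (ℤ.neg-distribʳ-* (+ m) (+ suc n)) ⟨
    ⟦ ℤ.- (+ m ℤ.* + suc n) ⟧ᶻ    ≈⟨ -‿homo (+ m ℤ.* + suc n) ⟩
    - ⟦ + m ℤ.* + suc n ⟧ᶻ        ≈⟨ -‿cong (pos-*-homo m (+ suc n)) ⟩
    - (⟦ + m ⟧ᶻ * ⟦ + suc n ⟧ᶻ)   ≈⟨ -‿distribʳ-* _ _ ⟩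
    ⟦ + m ⟧ᶻ * - ⟦ + suc n ⟧ᶻ     ∎

  *-homo : ∀ i j → ⟦ i ℤ.* j ⟧ᶻ ≈ ⟦ i ⟧ᶻ * ⟦ j ⟧ᶻ
  *-homo (+ m)    j = pos-*-homo m j
  *-homo -[1+ m ] j = begin
    ⟦ -[1+ m ] ℤ.* j ⟧ᶻ           ≈⟨ ⟦⟧ᶻ-cong (ℤ.neg-distribˡ-* (+ suc m) j) ⟨
    ⟦ ℤ.- (+ suc m ℤ.* j) ⟧ᶻ      ≈⟨ -‿homo (+ suc m ℤ.* j) ⟩
    - ⟦ + suc m ℤ.* j ⟧ᶻ          ≈⟨ -‿cong (pos-*-homo (suc m) j) ⟩
    - (⟦ + suc m ⟧ᶻ * ⟦ j ⟧ᶻ)     ≈⟨ -‿distribˡ-* _ _ ⟩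
    - ⟦ + suc m ⟧ᶻ * ⟦ j ⟧ᶻ       ∎

  morphism : ℤ.+-*-rawRing -Raw-AlmostCommutative⟶ almostCommutativeRing
  morphism = record
    { ⟦_⟧    = ⟦_⟧ᶻ
    ; +-homo = +-homo
    ; *-homo = *-homo
    ; -‿homo = -‿homo
    ; 0-homo = refl
    ; 1-homo = refl
    }

  -- Only positive answers are given, because distinct integers may have the same image in a
  -- commutative ring.
  _≟ᶻ_ : ∀ i j → Maybe (⟦ i ⟧ᶻ ≈ ⟦ j ⟧ᶻ)
  i ≟ᶻ j with i ℤ.≟ j
  ... | yes i≡j = just (⟦⟧ᶻ-cong i≡j)
  ... | no  _   = nothing

  open RingSolver ℤ.+-*-rawRing almostCommutativeRing morphism _≟ᶻ_ public
    using (solve; _:=_; _:+_; _:-_; _:*_; :-_; con)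

-- Arithmetic and order in an ordered field

module OrderedField (R : CompleteOrderedField) where

  open CompleteOrderedField R public
  open IsTotalOrder isTotalOrder public
    using (total)
    renaming ( refl to ≤-refl; trans to ≤-trans; antisym to ≤-antisym; reflexive to ≤-reflexive
             ; ≤-respˡ-≈ to ≤-respˡ; ≤-respʳ-≈ to ≤-respʳ )
  open IntegerCoefficients commutativeRing public
    using (solve; _:=_; _:+_; _:-_; _:*_; :-_; con)
  open RingProperties ring public using (-0#≈0#; -‿involutive)
  open SetoidReasoning setoid

  private variable
    x y z : Carrier

  x≤y⇒0≤y-x : x ≤ y → 0# ≤ y - x
  x≤y⇒0≤y-x {x} x≤y = ≤-respˡ (-‿inverseʳ x) (+-monoˡ-≤ (- x) x≤y)

  -- The bridge from algebra to order: an inequality follows once the ring solver writes the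
  -- difference of its sides as a quantity known to be nonnegative.
  x≈y-z∧0≤x⇒z≤y : x ≈ y - z → 0# ≤ x → z ≤ y
  x≈y-z∧0≤x⇒z≤y {x} {y} {z} x≈y-z 0≤x =
    ≤-respˡ (+-identityˡ z) (≤-respʳ (trans (+-congʳ x≈y-z) (solve 2 (λ a b → a :- b :+ b := a) refl y z))
      (+-monoˡ-≤ z 0≤x))

  0≤y-x⇒x≤y : 0# ≤ y - x → x ≤ y
  0≤y-x⇒x≤y = x≈y-z∧0≤x⇒z≤y refl

  +-nonneg : 0# ≤ x → 0# ≤ y → 0# ≤ x + y
  +-nonneg {x} {y} 0≤x 0≤y = ≤-trans 0≤y (≤-respˡ (+-identityˡ y) (+-monoˡ-≤ y 0≤x))

  +-mono-≤ : ∀ {u v} → x ≤ y → u ≤ v → x + u ≤ y + v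
  +-mono-≤ {x} {y} {u} {v} x≤y u≤v = x≈y-z∧0≤x⇒z≤y
    (solve 4 (λ x y u v → (y :- x) :+ (v :- u) := (y :+ v) :- (x :+ u)) refl x y u v)
    (+-nonneg (x≤y⇒0≤y-x x≤y) (x≤y⇒0≤y-x u≤v))

  *-monoˡ-≤ : 0# ≤ z → x ≤ y → z * x ≤ z * y
  *-monoˡ-≤ {z} {x} {y} 0≤z x≤y = x≈y-z∧0≤x⇒z≤y
    (solve 3 (λ x y z → z :* (y :- x) := z :* y :- z :* x) refl x y z)
    (*-nonneg 0≤z (x≤y⇒0≤y-x x≤y))

  0≤x*x : ∀ x → 0# ≤ x * x
  0≤x*x x with total 0# x
  ... | inj₁ 0≤x = *-nonneg 0≤x 0≤x
  ... | inj₂ x≤0 = ≤-respʳ (solve 1 (λ x → :- x :* :- x := x :* x) refl x) (*-nonneg 0≤-x 0≤-x)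
    where
    0≤-x : 0# ≤ - x
    0≤-x = ≤-respʳ (+-identityˡ (- x)) (x≤y⇒0≤y-x x≤0)

  0<1 : 0# < 1#
  0<1 = ≤-respʳ (*-identityˡ 1#) (0≤x*x 1#) , 0≉1

  <⇒≱ : x < y → ¬ y ≤ x
  <⇒≱ (x≤y , x≉y) y≤x = x≉y (≤-antisym x≤y y≤x)

  <-≤-trans : x < y → y ≤ z → x < z
  <-≤-trans x<y@(x≤y , _) y≤z =
    ≤-trans x≤y y≤z , λ x≈z → <⇒≱ x<y (≤-respʳ (sym x≈z) y≤z)

  ≤-<-trans : x ≤ y → y < z → x < z
  ≤-<-trans x≤y y<z@(y≤z , _) =
    ≤-trans x≤y y≤z , λ x≈z → <⇒≱ y<z (≤-respˡ x≈z x≤y)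

  <-resp-≈ : ∀ {u v} → x ≈ u → y ≈ v → x < y → u < v
  <-resp-≈ x≈u y≈v x<y = ≤-<-trans (≤-reflexive (sym x≈u)) (<-≤-trans x<y (≤-reflexive y≈v))

  pos⇒≉0 : 0# < x → ¬ x ≈ 0#
  pos⇒≉0 (_ , 0≉x) x≈0 = 0≉x (sym x≈0)

  x<y⇒0<y-x : x < y → 0# < y - x
  x<y⇒0<y-x {x} {y} (x≤y , x≉y) = x≤y⇒0≤y-x x≤y , λ 0≈y-x → x≉y (begin
    x              ≈⟨ +-identityˡ x ⟨
    0# + x         ≈⟨ +-congʳ 0≈y-x ⟩
    (y - x) + x    ≈⟨ solve 2 (λ x y → (y :- x) :+ x := y) refl x y ⟩
    y              ∎)

  0<y-x⇒x<y : 0# < y - x → x < y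
  0<y-x⇒x<y {y} {x} (0≤y-x , 0≉y-x) = 0≤y-x⇒x≤y 0≤y-x , λ x≈y →
    0≉y-x (trans (sym (-‿inverseʳ x)) (+-congʳ x≈y))

  x-y<z⇒x-z<y : x - y < z → x - z < y
  x-y<z⇒x-z<y {x} {y} {z} x-y<z = 0<y-x⇒x<y (<-resp-≈ refl
    (solve 3 (λ x y z → z :- (x :- y) := y :- (x :- z)) refl x y z) (x<y⇒0<y-x x-y<z))

  +-pos : 0# < x → 0# ≤ y → 0# < x + y
  +-pos {x} {y} 0<x 0≤y = <-≤-trans 0<x
    (≤-respˡ (+-identityʳ x) (+-mono-≤ ≤-refl 0≤y))

  +-mono-<-≤ : ∀ {u v} → x < y → u ≤ v → x + u < y + v
  +-mono-<-≤ {x} {y} {u} {v} (x≤y , x≉y) u≤v = +-mono-≤ x≤y u≤v , λ x+u≈y+v →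
    x≉y (≤-antisym x≤y (≤-respˡ (cancel y v) (≤-respʳ (cancel x v)
      (+-monoˡ-≤ (- v) (≤-trans (≤-reflexive (sym x+u≈y+v)) (+-mono-≤ ≤-refl u≤v))))))
    where
    cancel : ∀ x v → x + v - v ≈ x
    cancel = solve 2 (λ x v → x :+ v :- v := x) refl

  *-cancelˡ-≈ : ¬ z ≈ 0# → z * x ≈ z * y → x ≈ y
  *-cancelˡ-≈ {z} {x} {y} z≉0 zx≈zy with z⁻¹ , zz⁻¹≈1 ← inverse z z≉0 = begin
    x                ≈⟨ *-identityˡ x ⟨
    1# * x           ≈⟨ *-congʳ zz⁻¹≈1 ⟨
    z * z⁻¹ * x      ≈⟨ solve 3 (λ x z i → z :* i :* x := i :* (z :* x)) refl x z z⁻¹ ⟩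
    z⁻¹ * (z * x)    ≈⟨ *-congˡ zx≈zy ⟩
    z⁻¹ * (z * y)    ≈⟨ solve 3 (λ x z i → i :* (z :* x) := z :* i :* x) refl y z z⁻¹ ⟩
    z * z⁻¹ * y      ≈⟨ *-congʳ zz⁻¹≈1 ⟩
    1# * y           ≈⟨ *-identityˡ y ⟩
    y                ∎

  *-≉0 : ¬ x ≈ 0# → ¬ y ≈ 0# → ¬ x * y ≈ 0#
  *-≉0 {x} x≉0 y≉0 xy≈0 = y≉0 (*-cancelˡ-≈ x≉0 (trans xy≈0 (sym (zeroʳ x))))

  *-pos : 0# < x → 0# < y → 0# < x * y
  *-pos 0<x 0<y = *-nonneg (proj₁ 0<x) (proj₁ 0<y) ,
    λ 0≈xy → *-≉0 (pos⇒≉0 0<x) (pos⇒≉0 0<y) (sym 0≈xy)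

  *-cancelˡ-≤ : 0# < z → z * x ≤ z * y → x ≤ y
  *-cancelˡ-≤ {z} {x} {y} 0<z zx≤zy with total x y
  ... | inj₁ x≤y = x≤y
  ... | inj₂ y≤x = ≤-reflexive (*-cancelˡ-≈ (pos⇒≉0 0<z) (≤-antisym zx≤zy (*-monoˡ-≤ (proj₁ 0<z) y≤x)))

  *-cancelˡ-pos : 0# < z → 0# < z * x → 0# < x
  *-cancelˡ-pos {z} 0<z (0≤zx , 0≉zx) =
    *-cancelˡ-≤ 0<z (≤-respˡ (sym (zeroʳ z)) 0≤zx) ,
    λ 0≈x → 0≉zx (trans (sym (zeroʳ z)) (*-congˡ 0≈x))

  *-mono-≤ : 0# ≤ x → x ≤ y → x * x ≤ y * y
  *-mono-≤ {x} {y} 0≤x x≤y = ≤-trans (*-monoˡ-≤ 0≤x x≤y)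
    (≤-respˡ (*-comm y x) (*-monoˡ-≤ (≤-trans 0≤x x≤y) x≤y))

  *-mono-< : 0# ≤ x → x < y → x * x < y * y
  *-mono-< {x} {y} 0≤x x<y@(x≤y , _) = ≤-<-trans (*-monoˡ-≤ 0≤x x≤y)
    (0<y-x⇒x<y (<-resp-≈ refl (solve 2 (λ x y → y :* (y :- x) := y :* y :- x :* y) refl x y)
      (*-pos (≤-<-trans 0≤x x<y) (x<y⇒0<y-x x<y))))

  -- The order forces 1 + 1 to be positive, hence cancellable. Applied to imaginary parts, this
  -- turns invariance under conjugation into reality.
  x≈-x⇒x≈0 : x ≈ - x → x ≈ 0#
  x≈-x⇒x≈0 {x} x≈-x = *-cancelˡ-≈ (pos⇒≉0 (+-pos 0<1 (proj₁ 0<1))) (begin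
    (1# + 1#) * x    ≈⟨ distribʳ x 1# 1# ⟩
    1# * x + 1# * x  ≈⟨ +-cong (*-identityˡ x) (*-identityˡ x) ⟩
    x + x            ≈⟨ +-congˡ x≈-x ⟩
    x - x            ≈⟨ -‿inverseʳ x ⟩
    0#               ≈⟨ zeroʳ _ ⟨
    (1# + 1#) * 0#   ∎)

  divide : ∀ {k ε} → 0# < k → 0# < ε → ∃[ δ ] (0# < δ × k * δ ≈ ε)
  divide {k} {ε} 0<k 0<ε with k⁻¹ , kk⁻¹≈1 ← inverse k (pos⇒≉0 0<k) =
    k⁻¹ * ε , *-cancelˡ-pos 0<k (<-resp-≈ refl (sym kδ≈ε) 0<ε) , kδ≈ε
    where
    kδ≈ε : k * (k⁻¹ * ε) ≈ ε
    kδ≈ε = trans (sym (*-assoc k k⁻¹ ε)) (trans (*-congʳ kk⁻¹≈1) (*-identityˡ ε))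

  -- A substitute for the square root of ε: δ = ε / (1 + ε) lies below both ε and 1, so δ² ≤ δ ≤ ε.
  [1+ε]δ≈ε⇒δδ≤ε : ∀ {δ ε} → 0# < δ → 0# < ε → (1# + ε) * δ ≈ ε → δ * δ ≤ ε
  [1+ε]δ≈ε⇒δδ≤ε {δ} {ε} (0≤δ , _) 0<ε [1+ε]δ≈ε = ≤-trans δδ≤δ δ≤ε
    where
    δ+εδ≈ε : δ + ε * δ ≈ ε
    δ+εδ≈ε = trans (+-congʳ (sym (*-identityˡ δ))) (trans (sym (distribʳ δ 1# ε)) [1+ε]δ≈ε)
    δ≤ε : δ ≤ ε
    δ≤ε = ≤-respˡ (+-identityʳ δ) (≤-respʳ δ+εδ≈ε (+-mono-≤ ≤-refl (*-nonneg (proj₁ 0<ε) 0≤δ)))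
    εδ≤ε : ε * δ ≤ ε
    εδ≤ε = ≤-respˡ (+-identityˡ _) (≤-respʳ δ+εδ≈ε (+-mono-≤ 0≤δ ≤-refl))
    δδ≤δ : δ * δ ≤ δ
    δδ≤δ = ≤-respʳ (*-identityʳ δ) (*-monoˡ-≤ 0≤δ
      (*-cancelˡ-≤ 0<ε (≤-respʳ (sym (*-identityʳ ε)) εδ≤ε)))

  root-below : ∀ {ε} → 0# < ε → ∃[ δ ] (0# < δ × δ * δ ≤ ε)
  root-below 0<ε =
    let δ , 0<δ , [1+ε]δ≈ε = divide (+-pos 0<1 (proj₁ 0<ε)) 0<ε in
    δ , 0<δ , [1+ε]δ≈ε⇒δδ≤ε 0<δ 0<ε [1+ε]δ≈ε

module _ {g : Level} (R : CompleteOrderedField) (em : ExcludedMiddle g) where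

  open Analysis R em hiding (module ℂ)
  private module ℝ = OrderedField R

  -- Complex numbers: ring structure, conjugation, squared modulus, division

  complexRing : CommutativeRing 0ℓ 0ℓ
  complexRing = record
    { Carrier = ℂ ; _≈_ = _≈_ ; _+_ = _+_ ; _*_ = _*_ ; -_ = -_ ; 0# = 0ℂ ; 1# = ↑ 1ʳ
    ; isCommutativeRing = record
      { isRing = record
        { +-isAbelianGroup = record
          { isGroup = record
            { isMonoid = record
              { isSemigroup = record
                { isMagma = record
                  { isEquivalence = record
                    { refl  = ℝ.refl , ℝ.refl
                    ; sym   = λ (p , q) → ℝ.sym p , ℝ.sym q
                    ; trans = λ (p , q) (p′ , q′) → ℝ.trans p p′ , ℝ.trans q q′
                    }
                  ; ∙-cong = λ (p , q) (p′ , q′) → ℝ.+-cong p p′ , ℝ.+-cong q q′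
                  }
                ; assoc = λ x y z → ℝ.+-assoc _ _ _ , ℝ.+-assoc _ _ _
                }
              ; identity = (λ x → ℝ.+-identityˡ _ , ℝ.+-identityˡ _)
                         , (λ x → ℝ.+-identityʳ _ , ℝ.+-identityʳ _)
              }
            ; inverse = (λ x → ℝ.-‿inverseˡ _ , ℝ.-‿inverseˡ _)
                      , (λ x → ℝ.-‿inverseʳ _ , ℝ.-‿inverseʳ _)
            ; ⁻¹-cong = λ (p , q) → ℝ.-‿cong p , ℝ.-‿cong q
            }
          ; comm = λ x y → ℝ.+-comm _ _ , ℝ.+-comm _ _
          }
        ; *-cong     = *-cong
        ; *-assoc    = *-assoc
        ; *-identity = *-identityˡ , λ x → ≈-trans (*-comm x (↑ 1ʳ)) (*-identityˡ x)
        ; distrib    = *-distribˡ , λ x y z → ≈-trans (*-comm (y + z) x)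
            (≈-trans (*-distribˡ x y z) (+-cong (*-comm x y) (*-comm x z)))
        }
      ; *-comm = *-comm
      }
    }
    where
    open ℝ using (solve; _:=_; _:+_; _:-_; _:*_; :-_)
    ≈-trans : ∀ {x y z} → x ≈ y → y ≈ z → x ≈ z
    ≈-trans (p , q) (p′ , q′) = ℝ.trans p p′ , ℝ.trans q q′
    +-cong : ∀ {x y z t} → x ≈ y → z ≈ t → x + z ≈ y + t
    +-cong (p , q) (p′ , q′) = ℝ.+-cong p p′ , ℝ.+-cong q q′
    *-cong : ∀ {x y z t} → x ≈ y → z ≈ t → x * z ≈ y * t
    *-cong (p , q) (p′ , q′) =
      ℝ.+-cong (ℝ.*-cong p p′) (ℝ.-‿cong (ℝ.*-cong q q′)) ,
      ℝ.+-cong (ℝ.*-cong p q′) (ℝ.*-cong q p′)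
    *-assoc : ∀ x y z → (x * y) * z ≈ x * (y * z)
    *-assoc (a +i b) (c +i d) (e +i f) =
      solve 6 (λ a b c d e f → (a :* c :- b :* d) :* e :- (a :* d :+ b :* c) :* f
        := a :* (c :* e :- d :* f) :- b :* (c :* f :+ d :* e)) ℝ.refl a b c d e f ,
      solve 6 (λ a b c d e f → (a :* c :- b :* d) :* f :+ (a :* d :+ b :* c) :* e
        := a :* (c :* f :+ d :* e) :+ b :* (c :* e :- d :* f)) ℝ.refl a b c d e f
    *-comm : ∀ x y → x * y ≈ y * x
    *-comm (a +i b) (c +i d) =
      solve 4 (λ a b c d → a :* c :- b :* d := c :* a :- d :* b) ℝ.refl a b c d ,
      solve 4 (λ a b c d → a :* d :+ b :* c := c :* b :+ d :* a) ℝ.refl a b c d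
    *-identityˡ : ∀ x → ↑ 1ʳ * x ≈ x
    *-identityˡ (a +i b) =
      ℝ.trans (ℝ.+-cong (ℝ.*-identityˡ a) (ℝ.-‿cong (ℝ.zeroˡ b)))
              (ℝ.trans (ℝ.+-congˡ ℝ.-0#≈0#) (ℝ.+-identityʳ a)) ,
      ℝ.trans (ℝ.+-cong (ℝ.*-identityˡ b) (ℝ.zeroˡ a)) (ℝ.+-identityʳ b)
    *-distribˡ : ∀ x y z → x * (y + z) ≈ x * y + x * z
    *-distribˡ (a +i b) (c +i d) (e +i f) =
      solve 6 (λ a b c d e f → a :* (c :+ e) :- b :* (d :+ f)
        := (a :* c :- b :* d) :+ (a :* e :- b :* f)) ℝ.refl a b c d e f ,
      solve 6 (λ a b c d e f → a :* (d :+ f) :+ b :* (c :+ e)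
        := (a :* d :+ b :* c) :+ (a :* f :+ b :* e)) ℝ.refl a b c d e f

  module ℂ where
    open CommutativeRing complexRing public hiding (_≈_; _+_; _*_; -_; _-_; Carrier)
    open IntegerCoefficients complexRing public using (solve; _:=_; _:+_; _:-_; _:*_; :-_; con)

  private variable
    x y : ℝ
    z z′ t t′ : ℂ

  ↑-cong : x ≈ʳ y → ↑ x ≈ ↑ y
  ↑-cong x≈y = x≈y , ℝ.refl

  ↑-+ : ∀ x y → ↑ (x +ʳ y) ≈ ↑ x + ↑ y
  ↑-+ x y = ℝ.refl , ℝ.sym (ℝ.+-identityʳ _)

  ↑-neg : ∀ x → ↑ (-ʳ x) ≈ - ↑ x
  ↑-neg x = ℝ.refl , ℝ.sym ℝ.-0#≈0#

  ↑-scale : ∀ x z → ↑ x * z ≈ (x *ʳ re z) +i (x *ʳ im z)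
  ↑-scale x z =
    ℝ.trans (ℝ.+-congˡ (ℝ.trans (ℝ.-‿cong (ℝ.zeroˡ _)) ℝ.-0#≈0#)) (ℝ.+-identityʳ _) ,
    ℝ.trans (ℝ.+-congˡ (ℝ.zeroˡ _)) (ℝ.+-identityʳ _)

  ↑-* : ∀ x y → ↑ (x *ʳ y) ≈ ↑ x * ↑ y
  ↑-* x y = ℂ.sym (ℂ.trans (↑-scale x (↑ y)) (ℝ.refl , ℝ.zeroʳ x))

  real⇒↑re : im z ≈ʳ 0ʳ → z ≈ ↑ re z
  real⇒↑re im≈0 = ℝ.refl , im≈0

  conj-cong : z ≈ t → conj z ≈ conj t
  conj-cong (p , q) = p , ℝ.-‿cong q

  conj-+ : ∀ z t → conj (z + t) ≈ conj z + conj t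
  conj-+ z t = ℝ.refl , ℝ.solve 2 (λ a b → ℝ.:- (a ℝ.:+ b) ℝ.:= ℝ.:- a ℝ.:+ ℝ.:- b) ℝ.refl _ _

  conj-- : ∀ z t → conj (z - t) ≈ conj z - conj t
  conj-- z t = conj-+ z (- t)

  conj-* : ∀ z t → conj (z * t) ≈ conj z * conj t
  conj-* (a +i b) (c +i d) =
    solve 4 (λ a b c d → a :* c :- b :* d := a :* c :- :- b :* :- d) ℝ.refl a b c d ,
    solve 4 (λ a b c d → :- (a :* d :+ b :* c) := a :* :- d :+ :- b :* c) ℝ.refl a b c d
    where open ℝ using (solve; _:=_; _:+_; _:-_; _:*_; :-_)

  conj-involutive : ∀ z → conj (conj z) ≈ z
  conj-involutive z = ℝ.refl , ℝ.-‿involutive _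

  conj-real : im z ≈ʳ 0ʳ → conj z ≈ z
  conj-real im≈0 = ℝ.refl , ℝ.trans (ℝ.-‿cong im≈0) (ℝ.trans ℝ.-0#≈0# (ℝ.sym im≈0))

  conj-fixed⇒real : conj z ≈ z → im z ≈ʳ 0ʳ
  conj-fixed⇒real (_ , -im≈im) = ℝ.x≈-x⇒x≈0 (ℝ.sym -im≈im)

  re+re : ∀ z → z + conj z ≈ 2ℂ * ↑ re z
  re+re (a +i b) = ℂ.trans (a+a≈2a , ℝ.-‿inverseʳ b) (↑-* _ a)
    where
    a+a≈2a : a +ʳ a ≈ʳ (1ʳ +ʳ 1ʳ) *ʳ a
    a+a≈2a = ℝ.sym (ℝ.trans (ℝ.distribʳ a 1ʳ 1ʳ) (ℝ.+-cong (ℝ.*-identityˡ a) (ℝ.*-identityˡ a)))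

  ∣∣²-cong : z ≈ t → ∣ z ∣² ≈ʳ ∣ t ∣²
  ∣∣²-cong (p , q) = ℝ.+-cong (ℝ.*-cong p p) (ℝ.*-cong q q)

  ∣∣²-nonneg : ∀ z → 0ʳ ≤ ∣ z ∣²
  ∣∣²-nonneg z = ℝ.+-nonneg (ℝ.0≤x*x (re z)) (ℝ.0≤x*x (im z))

  re²≤∣∣² : ∀ z → re z *ʳ re z ≤ ∣ z ∣²
  re²≤∣∣² z = ℝ.≤-respˡ (ℝ.+-identityʳ _) (ℝ.+-mono-≤ ℝ.≤-refl (ℝ.0≤x*x (im z)))

  z*conj-z : ∀ z → z * conj z ≈ ↑ ∣ z ∣²
  z*conj-z (a +i b) =
    solve 2 (λ a b → a :* a :- b :* :- b := a :* a :+ b :* b) ℝ.refl a b ,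
    ℝ.trans (solve 2 (λ a b → a :* :- b :+ b :* a := a :- a) ℝ.refl a b) (ℝ.-‿inverseʳ a)
    where open ℝ using (solve; _:=_; _:+_; _:-_; _:*_; :-_)

  ∣z*t∣² : ∀ z t → ∣ z * t ∣² ≈ʳ ∣ z ∣² *ʳ ∣ t ∣²
  ∣z*t∣² (a +i b) (c +i d) =
    solve 4 (λ a b c d →
      (a :* c :- b :* d) :* (a :* c :- b :* d) :+ (a :* d :+ b :* c) :* (a :* d :+ b :* c)
      := (a :* a :+ b :* b) :* (c :* c :+ d :* d)) ℝ.refl a b c d
    where open ℝ using (solve; _:=_; _:+_; _:-_; _:*_; :-_)

  ∣conj∣² : ∀ z → ∣ conj z ∣² ≈ʳ ∣ z ∣²
  ∣conj∣² (a +i b) = solve 2 (λ a b → a :* a :+ :- b :* :- b := a :* a :+ b :* b) ℝ.refl a b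
    where open ℝ using (solve; _:=_; _:+_; _:-_; _:*_; :-_)

  ∣-∣²-comm : ∀ z t → ∣ z - t ∣² ≈ʳ ∣ t - z ∣²
  ∣-∣²-comm (a +i b) (c +i d) =
    solve 4 (λ a b c d → (a :- c) :* (a :- c) :+ (b :- d) :* (b :- d)
      := (c :- a) :* (c :- a) :+ (d :- b) :* (d :- b)) ℝ.refl a b c d
    where open ℝ using (solve; _:=_; _:+_; _:-_; _:*_; :-_)

  -- The difference of the two sides is |z - t|². With squared moduli only, this takes the place of
  -- the triangle inequality.
  parallelogram : ∀ z t → ∣ z + t ∣² ≤ (∣ z ∣² +ʳ ∣ t ∣²) +ʳ (∣ z ∣² +ʳ ∣ t ∣²)
  parallelogram (a +i b) (c +i d) = ℝ.x≈y-z∧0≤x⇒z≤y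
    (solve 4 (λ a b c d → (a :- c) :* (a :- c) :+ (b :- d) :* (b :- d)
      := (((a :* a :+ b :* b) :+ (c :* c :+ d :* d)) :+ ((a :* a :+ b :* b) :+ (c :* c :+ d :* d)))
         :- ((a :+ c) :* (a :+ c) :+ (b :+ d) :* (b :+ d))) ℝ.refl a b c d)
    (∣∣²-nonneg ((a +i b) - (c +i d)))
    where open ℝ using (solve; _:=_; _:+_; _:-_; _:*_; :-_)

  x²+y²≈0⇒x≈0 : x *ʳ x +ʳ y *ʳ y ≈ʳ 0ʳ → x ≈ʳ 0ʳ
  x²+y²≈0⇒x≈0 {x} {y} x²+y²≈0 with decide (x ≈ʳ 0ʳ)
  ... | yes x≈0 = x≈0
  ... | no  x≉0 = contradiction
    (ℝ.≤-antisym (ℝ.≤-respʳ x²+y²≈0 (ℝ.≤-respˡ (ℝ.+-identityʳ _) (ℝ.+-mono-≤ ℝ.≤-refl (ℝ.0≤x*x y))))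
                 (ℝ.0≤x*x x))
    (ℝ.*-≉0 x≉0 x≉0)

  ∣z∣²≈0⇒z≈0 : ∣ z ∣² ≈ʳ 0ʳ → z ≈ 0ℂ
  ∣z∣²≈0⇒z≈0 ∣z∣²≈0 = x²+y²≈0⇒x≈0 ∣z∣²≈0 , x²+y²≈0⇒x≈0 (ℝ.trans (ℝ.+-comm _ _) ∣z∣²≈0)

  ∣∣²-pos : ¬ z ≈ 0ℂ → 0ʳ < ∣ z ∣²
  ∣∣²-pos {z} z≉0 = ∣∣²-nonneg z , λ 0≈∣z∣² → z≉0 (∣z∣²≈0⇒z≈0 (ℝ.sym 0≈∣z∣²))

  *-inverseʳ : ¬ x ≈ʳ 0ʳ → x *ʳ x ⁻¹ ≈ʳ 1ʳ
  *-inverseʳ {x} x≉0 with decide (x ≈ʳ 0ʳ)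
  ... | yes x≈0 = contradiction x≈0 x≉0
  ... | no x≉0′ = proj₂ (ℝ.inverse x x≉0′)

  /-*-cancel : ∀ t → ¬ z ≈ 0ℂ → (t / z) * z ≈ t
  /-*-cancel {z} t z≉0 = begin
    t * (conj z * ↑ (∣ z ∣² ⁻¹)) * z   ≈⟨ solve 4 (λ t c i z → t :* (c :* i) :* z := t :* ((z :* c) :* i))
                                            ℂ.refl t (conj z) (↑ (∣ z ∣² ⁻¹)) z ⟩
    t * (z * conj z * ↑ (∣ z ∣² ⁻¹))   ≈⟨ ℂ.*-congˡ (ℂ.*-congʳ (z*conj-z z)) ⟩
    t * (↑ ∣ z ∣² * ↑ (∣ z ∣² ⁻¹))     ≈⟨ ℂ.*-congˡ (↑-* _ _) ⟨
    t * ↑ (∣ z ∣² *ʳ ∣ z ∣² ⁻¹)        ≈⟨ ℂ.*-congˡ (↑-cong (*-inverseʳ (ℝ.pos⇒≉0 (∣∣²-pos z≉0)))) ⟩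
    t * ↑ 1ʳ                           ≈⟨ ℂ.*-identityʳ t ⟩
    t                                  ∎
    where
    open SetoidReasoning ℂ.setoid
    open ℂ using (solve; _:=_; _:*_)

  *-cancelʳ : ¬ z ≈ 0ℂ → t * z ≈ t′ * z → t ≈ t′
  *-cancelʳ {z} {t} {t′} z≉0 tz≈t′z = ℂ.trans (ℂ.sym (invert t)) (ℂ.trans (ℂ.*-congʳ tz≈t′z) (invert t′))
    where
    z⁻¹ = ↑ 1ʳ / z
    invert : ∀ t → t * z * z⁻¹ ≈ t
    invert t = ℂ.trans (ℂ.*-assoc t z z⁻¹) (ℂ.trans (ℂ.*-congˡ (ℂ.trans (ℂ.*-comm z z⁻¹) (/-*-cancel (↑ 1ʳ) z≉0)))
      (ℂ.*-identityʳ t))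

  *≈⇒≈/ : ¬ z ≈ 0ℂ → t * z ≈ t′ → t ≈ t′ / z
  *≈⇒≈/ {t′ = t′} z≉0 tz≈t′ = *-cancelʳ z≉0 (ℂ.trans tz≈t′ (ℂ.sym (/-*-cancel t′ z≉0)))

  re-*-real : ∀ z → im t ≈ʳ 0ʳ → re (z * t) ≈ʳ re z *ʳ re t
  re-*-real z im≈0 = ℝ.trans (ℝ.+-congˡ (ℝ.-‿cong (ℝ.trans (ℝ.*-congˡ im≈0) (ℝ.zeroʳ (im z)))))
    (ℝ.trans (ℝ.+-congˡ ℝ.-0#≈0#) (ℝ.+-identityʳ _))

  -- The decision is an argument, so that the branch in `β` is resolved by matching on it rather
  -- than by unfolding `decide`. A positive real part rules out the default value.
  guarded-quotient : ∀ x z → im z ≈ʳ 0ʳ → 0ʳ < re z → (z≟0 : Dec (z ≈ 0ℂ)) →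
    (if does z≟0 then 0ʳ else re (↑ x / z)) *ʳ re z ≈ʳ x
  guarded-quotient x z im≈0 0<re (yes (re≈0 , _)) = contradiction re≈0 (ℝ.pos⇒≉0 0<re)
  guarded-quotient x z im≈0 0<re (no z≉0)         =
    ℝ.trans (ℝ.sym (re-*-real (↑ x / z) im≈0)) (proj₁ (/-*-cancel (↑ x) z≉0))

  -- Unconditional summation over finite subsets

  module Series {G : Set g} where

    private variable
      f h : G → ℂ
      a b : G → ℝ
      s : ℂ
      F F′ : List G

    finiteSum-cong : (∀ π → f π ≈ h π) → ∀ F → finiteSum f F ≈ finiteSum h F
    finiteSum-cong f≈h []      = ℂ.refl
    finiteSum-cong f≈h (π ∷ F) = ℂ.+-cong (f≈h π) (finiteSum-cong f≈h F)

    finiteSum-+ : ∀ (f h : G → ℂ) F → finiteSum (λ π → f π + h π) F ≈ finiteSum f F + finiteSum h F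
    finiteSum-+ f h []      = ℂ.sym (ℂ.+-identityˡ 0ℂ)
    finiteSum-+ f h (π ∷ F) = ℂ.trans (ℂ.+-congˡ (finiteSum-+ f h F))
      (solve 4 (λ x y u v → (x :+ y) :+ (u :+ v) := (x :+ u) :+ (y :+ v)) ℂ.refl
        (f π) (h π) (finiteSum f F) (finiteSum h F))
      where open ℂ using (solve; _:=_; _:+_)

    finiteSum-* : ∀ c (f : G → ℂ) F → finiteSum (λ π → c * f π) F ≈ c * finiteSum f F
    finiteSum-* c f []      = ℂ.sym (ℂ.zeroʳ c)
    finiteSum-* c f (π ∷ F) = ℂ.trans (ℂ.+-congˡ (finiteSum-* c f F)) (ℂ.sym (ℂ.distribˡ c _ _))

    finiteSum-conj : ∀ (f : G → ℂ) F → finiteSum (λ π → conj (f π)) F ≈ conj (finiteSum f F)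
    finiteSum-conj f []      = ℂ.sym (conj-real ℝ.refl)
    finiteSum-conj f (π ∷ F) = ℂ.trans (ℂ.+-congˡ (finiteSum-conj f F)) (ℂ.sym (conj-+ _ _))

    -- Read off from the complex sum that occurs in `HasSum`; by `partialSum-real` the imaginary
    -- part is zero, so nothing is lost.
    partialSum : (G → ℝ) → List G → ℝ
    partialSum a F = re (finiteSum (λ π → ↑ a π) F)

    partialSum-real : ∀ a F → finiteSum (λ π → ↑ a π) F ≈ ↑ partialSum a F
    partialSum-real a []      = ℂ.refl
    partialSum-real a (π ∷ F) = ℂ.trans (ℂ.+-congˡ (partialSum-real a F)) (ℂ.sym (↑-+ _ _))

    partialSum-mono-≤ : (∀ π → a π ≤ b π) → ∀ F → partialSum a F ≤ partialSum b F
    partialSum-mono-≤ a≤b []      = ℝ.≤-refl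
    partialSum-mono-≤ a≤b (π ∷ F) = ℝ.+-mono-≤ (a≤b π) (partialSum-mono-≤ a≤b F)

    partialSum-nonneg : (∀ π → 0ʳ ≤ a π) → ∀ F → 0ʳ ≤ partialSum a F
    partialSum-nonneg 0≤a []      = ℝ.≤-refl
    partialSum-nonneg 0≤a (π ∷ F) = ℝ.+-nonneg (0≤a π) (partialSum-nonneg 0≤a F)

    partialSum-insert : ∀ a ys π zs → partialSum a (ys ++ π ∷ zs) ≈ʳ a π +ʳ partialSum a (ys ++ zs)
    partialSum-insert a []       π zs = ℝ.refl
    partialSum-insert a (y ∷ ys) π zs = ℝ.trans (ℝ.+-congˡ (partialSum-insert a ys π zs))
      (solve 3 (λ x y z → x :+ (y :+ z) := y :+ (x :+ z)) ℝ.refl (a y) (a π) (partialSum a (ys ++ zs)))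
      where open ℝ using (solve; _:=_; _:+_)

    -- Induction on `F`: its head is cut out of `F′` at one occurrence, and since the head does not
    -- recur, the tail is still contained in what remains.
    partialSum-mono-⊆ : (∀ π → 0ʳ ≤ a π) → Unique F → F ⊆ F′ → partialSum a F ≤ partialSum a F′
    partialSum-mono-⊆ {F′ = F′} 0≤a [] F⊆F′ = partialSum-nonneg 0≤a F′
    partialSum-mono-⊆ {a = a} {F = π ∷ F} 0≤a (π∉F ∷ F!) F⊆F′ with ∈-∃++ (F⊆F′ (here ≡.refl))
    ... | ys , zs , ≡.refl = ℝ.≤-respʳ (ℝ.sym (partialSum-insert a ys π zs))
      (ℝ.+-mono-≤ ℝ.≤-refl (partialSum-mono-⊆ 0≤a F! F⊆ys++zs))
      where
      F⊆ys++zs : F ⊆ ys ++ zs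
      F⊆ys++zs x∈F with ∈-++⁻ ys (F⊆F′ (there x∈F))
      ... | inj₁ x∈ys           = ∈-++⁺ˡ x∈ys
      ... | inj₂ (here x≡π)     = contradiction (≡.sym x≡π) (All.lookup π∉F x∈F)
      ... | inj₂ (there x∈zs)   = ∈-++⁺ʳ ys x∈zs

    private
      _≟_ : DecidableEquality G
      π ≟ ρ = em {π ≡ ρ}

    -- `HasSum` tests lists without repetitions only, so the union of two finite sets has to be
    -- freed of duplicates before it can serve as a common refinement.
    nodup : List G → List G
    nodup = deduplicate _≟_

    nodup-! : ∀ F → Unique (nodup F)
    nodup-! = deduplicate-! _≟_

    ⊆-nodup : F ⊆ nodup F
    ⊆-nodup = ∈-deduplicate⁺ _≟_

    -- HasSum with ε in place of ε².
    Converges : (G → ℂ) → ℂ → Set g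
    Converges f s = ∀ ε → 0ʳ < ε → ∃[ F ] (∀ F′ → Unique F′ → F ⊆ F′ → ∣ finiteSum f F′ - s ∣² < ε)

    hasSum⇒converges : HasSum f s → Converges f s
    hasSum⇒converges f⟶s ε 0<ε =
      let δ , 0<δ , δδ≤ε = ℝ.root-below 0<ε
          F , close      = f⟶s δ 0<δ
      in F , λ F′ F′! F⊆F′ → ℝ.<-≤-trans (close F′ F′! F⊆F′) δδ≤ε

    converges⇒hasSum : Converges f s → HasSum f s
    converges⇒hasSum f⟶s ε 0<ε = f⟶s (ε *ʳ ε) (ℝ.*-pos 0<ε 0<ε)

    private
      -- The price of adding two errors of squared size below ε: by `parallelogram` the result is at
      -- most 2 (ε + ε).
      4ʳ : ℝ
      4ʳ = (1ʳ +ʳ 1ʳ) +ʳ (1ʳ +ʳ 1ʳ)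

      0<4 : 0ʳ < 4ʳ
      0<4 = ℝ.+-pos (ℝ.+-pos ℝ.0<1 (proj₁ ℝ.0<1)) (ℝ.+-nonneg (proj₁ ℝ.0<1) (proj₁ ℝ.0<1))

    ∣+∣²<4ε : ∀ {ε z t} → ∣ z ∣² < ε → ∣ t ∣² < ε → ∣ z + t ∣² < 4ʳ *ʳ ε
    ∣+∣²<4ε {ε} {z} {t} z<ε t<ε = ℝ.≤-<-trans (parallelogram z t)
      (ℝ.<-resp-≈ ℝ.refl (ℝ.sym 4ε≈) (ℝ.+-mono-<-≤ z+t<2ε (proj₁ z+t<2ε)))
      where
      z+t<2ε : ∣ z ∣² +ʳ ∣ t ∣² < ε +ʳ ε
      z+t<2ε = ℝ.+-mono-<-≤ z<ε (proj₁ t<ε)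
      2x≈x+x : ∀ x → (1ʳ +ʳ 1ʳ) *ʳ x ≈ʳ x +ʳ x
      2x≈x+x x = ℝ.trans (ℝ.distribʳ x 1ʳ 1ʳ) (ℝ.+-cong (ℝ.*-identityˡ x) (ℝ.*-identityˡ x))
      4ε≈ : 4ʳ *ʳ ε ≈ʳ (ε +ʳ ε) +ʳ (ε +ʳ ε)
      4ε≈ = ℝ.trans (ℝ.distribʳ ε _ _) (ℝ.+-cong (2x≈x+x ε) (2x≈x+x ε))

    hasSum-unique : HasSum f s → HasSum f t → s ≈ t
    hasSum-unique {f} {s} {t} f⟶s f⟶t with decide (s ≈ t)
    ... | yes s≈t = s≈t
    ... | no  s≉t = contradiction (ℝ.≤-reflexive ℝ.refl) (ℝ.<⇒≱ ∣s-t∣²<∣s-t∣²)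
      where
      open ℂ using (solve; _:=_; _:+_; _:-_)
      s-t≉0 : ¬ s - t ≈ 0ℂ
      s-t≉0 s-t≈0 = s≉t (begin
        s            ≈⟨ solve 2 (λ s t → s := (s :- t) :+ t) ℂ.refl s t ⟩
        (s - t) + t  ≈⟨ ℂ.+-congʳ s-t≈0 ⟩
        0ℂ + t       ≈⟨ ℂ.+-identityˡ t ⟩
        t            ∎)
        where open SetoidReasoning ℂ.setoid
      ∣s-t∣²<∣s-t∣² : ∣ s - t ∣² < ∣ s - t ∣²
      ∣s-t∣²<∣s-t∣² =
        -- ε is a quarter of |s - t|²: a finite sum that is ε-close to both limits forces |s - t|² <
        -- 4 ε, which is absurd.
        let ε , 0<ε , 4ε≈   = ℝ.divide 0<4 (∣∣²-pos s-t≉0)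
            F₁ , close₁     = hasSum⇒converges f⟶s ε 0<ε
            F₂ , close₂     = hasSum⇒converges f⟶t ε 0<ε
            F               = nodup (F₁ ++ F₂)
            S               = finiteSum f F
            S~s             = close₁ F (nodup-! _) (λ x∈ → ⊆-nodup (∈-++⁺ˡ x∈))
            S~t             = close₂ F (nodup-! _) (λ x∈ → ⊆-nodup (∈-++⁺ʳ F₁ x∈))
        in ℝ.<-resp-≈ (∣∣²-cong (solve 3 (λ s S t → (s :- S) :+ (S :- t) := s :- t) ℂ.refl s S t)) 4ε≈
             (∣+∣²<4ε (ℝ.<-resp-≈ (∣-∣²-comm S s) ℝ.refl S~s) S~t)

    ∑≈ : HasSum f s → ∑ f ≈ s
    ∑≈ {f} {s} f⟶s with em {Summable f}
    ... | yes (t , f⟶t) = hasSum-unique f⟶t f⟶s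
    ... | no  diverges  = contradiction (s , f⟶s) diverges

    hasSum-cong : (∀ π → f π ≈ h π) → HasSum f s → HasSum h s
    hasSum-cong f≈h f⟶s ε 0<ε =
      let F , close = f⟶s ε 0<ε
      in F , λ F′ F′! F⊆F′ →
        ℝ.<-resp-≈ (∣∣²-cong (ℂ.+-congʳ (finiteSum-cong f≈h F′))) ℝ.refl (close F′ F′! F⊆F′)

    hasSum-+ : HasSum f s → HasSum h t → HasSum (λ π → f π + h π) (s + t)
    hasSum-+ {f} {s} {h} {t} f⟶s h⟶t = converges⇒hasSum λ ε 0<ε →
      let δ , 0<δ , 4δ≈ε = ℝ.divide 0<4 0<ε
          F₁ , close₁    = hasSum⇒converges f⟶s δ 0<δ
          F₂ , close₂    = hasSum⇒converges h⟶t δ 0<δ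
      in F₁ ++ F₂ , λ F F! ⊆F →
        ℝ.<-resp-≈ (∣∣²-cong (split F)) 4δ≈ε
          (∣+∣²<4ε (close₁ F F! (λ x∈ → ⊆F (∈-++⁺ˡ x∈))) (close₂ F F! (λ x∈ → ⊆F (∈-++⁺ʳ F₁ x∈))))
      where
      open ℂ using (solve; _:=_; _:+_; _:-_)
      split : ∀ F → (finiteSum f F - s) + (finiteSum h F - t) ≈ finiteSum (λ π → f π + h π) F - (s + t)
      split F = ℂ.trans
        (solve 4 (λ x s y t → (x :- s) :+ (y :- t) := (x :+ y) :- (s :+ t)) ℂ.refl (finiteSum f F) s (finiteSum h F) t)
        (ℂ.+-congʳ (ℂ.sym (finiteSum-+ f h F)))

    hasSum-* : ∀ c → HasSum f s → HasSum (λ π → c * f π) (c * s)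
    hasSum-* {f} {s} c f⟶s = converges⇒hasSum λ ε 0<ε →
      -- Dividing by 1 + |c|² instead of |c|² covers c = 0, and the spare summand δ makes the final
      -- inequality strict.
      let δ , 0<δ , kδ≈ε = ℝ.divide (ℝ.+-pos ℝ.0<1 (∣∣²-nonneg c)) 0<ε
          F , close      = hasSum⇒converges f⟶s δ 0<δ
      in F , λ F′ F′! F⊆F′ →
        ℝ.≤-<-trans (ℝ.≤-reflexive (ℝ.trans (∣∣²-cong (factor F′)) (∣z*t∣² c _)))
          (ℝ.≤-<-trans (ℝ.*-monoˡ-≤ (∣∣²-nonneg c) (proj₁ (close F′ F′! F⊆F′)))
            (ℝ.<-resp-≈ (ℝ.+-identityˡ _) (ℝ.trans ([1+k]δ δ) kδ≈ε) (ℝ.+-mono-<-≤ 0<δ ℝ.≤-refl)))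
      where
      open ℂ using (solve; _:=_; _:*_; _:-_)
      factor : ∀ F → finiteSum (λ π → c * f π) F - c * s ≈ c * (finiteSum f F - s)
      factor F = ℂ.trans (ℂ.+-congʳ (finiteSum-* c f F))
        (solve 3 (λ c x s → c :* x :- c :* s := c :* (x :- s)) ℂ.refl c (finiteSum f F) s)
      [1+k]δ : ∀ δ → δ +ʳ ∣ c ∣² *ʳ δ ≈ʳ (1ʳ +ʳ ∣ c ∣²) *ʳ δ
      [1+k]δ δ = ℝ.trans (ℝ.+-congʳ (ℝ.sym (ℝ.*-identityˡ δ))) (ℝ.sym (ℝ.distribʳ δ 1ʳ _))

    hasSum-conj : HasSum f s → HasSum (λ π → conj (f π)) (conj s)
    hasSum-conj {f} {s} f⟶s ε 0<ε =
      let F , close = f⟶s ε 0<ε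
      in F , λ F′ F′! F⊆F′ → ℝ.<-resp-≈
        (ℝ.trans (ℝ.sym (∣conj∣² _))
          (∣∣²-cong (ℂ.trans (conj-- (finiteSum f F′) s) (ℂ.+-congʳ (ℂ.sym (finiteSum-conj f F′))))))
        ℝ.refl (close F′ F′! F⊆F′)

    hasSum-real : HasSum (λ π → ↑ a π) s → im s ≈ʳ 0ʳ
    hasSum-real a⟶s = conj-fixed⇒real
      (hasSum-unique (hasSum-cong (λ π → conj-real ℝ.refl) (hasSum-conj a⟶s)) a⟶s)

    -- If a partial sum exceeded the limit by `gap`, every larger finite set would stay at least as
    -- far above it, against convergence tested at ε = `gap`.
    partialSum≤sum : (∀ π → 0ʳ ≤ a π) → HasSum (λ π → ↑ a π) s → Unique F → partialSum a F ≤ re s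
    partialSum≤sum {a} {s} {F} 0≤a a⟶s F! with decide (partialSum a F ≤ re s)
    ... | yes ≤s = ≤s
    ... | no  ≰s = contradiction gap²≤ (ℝ.<⇒≱ <gap²)
      where
      gap = partialSum a F -ʳ re s
      s<sum : re s < partialSum a F
      s<sum with ℝ.total (re s) (partialSum a F)
      ... | inj₁ s≤ = s≤ , λ s≈ → ≰s (ℝ.≤-reflexive (ℝ.sym s≈))
      ... | inj₂ ≤s = contradiction ≤s ≰s
      0<gap : 0ʳ < gap
      0<gap = ℝ.x<y⇒0<y-x s<sum
      F₀ = proj₁ (a⟶s gap 0<gap)
      F₁ = nodup (F ++ F₀)
      <gap² : ∣ finiteSum (λ π → ↑ a π) F₁ - s ∣² < gap *ʳ gap
      <gap² = proj₂ (a⟶s gap 0<gap) F₁ (nodup-! _) (λ x∈ → ⊆-nodup (∈-++⁺ʳ F x∈))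
      gap≤ : gap ≤ partialSum a F₁ -ʳ re s
      gap≤ = ℝ.+-monoˡ-≤ _ (partialSum-mono-⊆ 0≤a F! (λ x∈ → ⊆-nodup (∈-++⁺ˡ x∈)))
      gap²≤ : gap *ʳ gap ≤ ∣ finiteSum (λ π → ↑ a π) F₁ - s ∣²
      gap²≤ = ℝ.≤-trans (ℝ.*-mono-≤ (proj₁ 0<gap) gap≤) (re²≤∣∣² (finiteSum (λ π → ↑ a π) F₁ - s))

    sum-nonneg : (∀ π → 0ʳ ≤ a π) → HasSum (λ π → ↑ a π) s → 0ʳ ≤ re s
    sum-nonneg 0≤a a⟶s = partialSum≤sum 0≤a a⟶s []

    -- Being a partial sum is a proposition in Set g; excluded middle brings it down to Set, as `supremum` requires.
    bounded⇒summable : ∀ {c} → (∀ π → 0ʳ ≤ a π) → (∀ F → Unique F → partialSum a F ≤ c) →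
                       Summable (λ π → ↑ a π)
    bounded⇒summable {a} {c} 0≤a bounded = ↑ top , converge
      where
      Attained : ℝ → Set g
      Attained x = ∃[ F ] (Unique F × partialSum a F ≈ʳ x)
      P : ℝ → Set
      P x = T (isYes (em {Attained x}))
      to : ∀ {x} → Attained x → P x
      to = fromWitness
      from : ∀ {x} → P x → Attained x
      from = toWitness
      sup = ℝ.supremum P (0ʳ , to ([] , [] , ℝ.refl))
        (c , λ x Px → let F , F! , S≈x = from Px in ℝ.≤-respˡ S≈x (bounded F F!))
      top = proj₁ sup
      sum≤top : ∀ {F} → Unique F → partialSum a F ≤ top
      sum≤top {F} F! = proj₁ (proj₂ sup) _ (to (F , F! , ℝ.refl))
      approach : ∀ ε → 0ʳ < ε → ∃[ F ] (Unique F × (top -ʳ ε) < partialSum a F)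
      approach ε 0<ε with em {∃[ F ] (Unique F × (top -ʳ ε) < partialSum a F)}
      ... | yes found = found
      -- If no partial sum lay above `top` - ε, that number would be an upper bound smaller than the
      -- least one.
      ... | no  none  = contradiction (proj₂ (proj₂ sup) (top -ʳ ε) top-ε-bounds) (ℝ.<⇒≱ top-ε<top)
        where
        top-ε<top : top -ʳ ε < top
        top-ε<top = ℝ.0<y-x⇒x<y (ℝ.<-resp-≈ ℝ.refl (ℝ.solve 2 (λ t ε → ε ℝ.:= t ℝ.:- (t ℝ.:- ε)) ℝ.refl top ε) 0<ε)
        top-ε-bounds : ∀ x → P x → x ≤ top -ʳ ε
        top-ε-bounds x Px with ℝ.total x (top -ʳ ε) | decide (top -ʳ ε ≈ʳ x)
        ... | inj₁ x≤ | _        = x≤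
        ... | inj₂ _  | yes ≈x   = ℝ.≤-reflexive (ℝ.sym ≈x)
        ... | inj₂ ≤x | no ≉x    = contradiction
          (let F , F! , S≈x = from Px in F , F! , ℝ.<-resp-≈ ℝ.refl (ℝ.sym S≈x) (≤x , ≉x)) none
      converge : HasSum (λ π → ↑ a π) (↑ top)
      converge ε 0<ε =
        let F , F! , top-ε<S = approach ε 0<ε in
        F , λ F′ F′! F⊆F′ →
          ℝ.<-resp-≈ (ℝ.sym (modulus F′)) ℝ.refl
            (ℝ.*-mono-< (ℝ.x≤y⇒0≤y-x (sum≤top F′!))
              (ℝ.x-y<z⇒x-z<y (ℝ.<-≤-trans top-ε<S (partialSum-mono-⊆ 0≤a F! F⊆F′))))
        where
        modulus : ∀ F → ∣ finiteSum (λ π → ↑ a π) F - ↑ top ∣² ≈ʳ (top -ʳ partialSum a F) *ʳ (top -ʳ partialSum a F)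
        modulus F = ℝ.trans (∣-∣²-comm _ _) (ℝ.trans
          (∣∣²-cong {t = ↑ (top -ʳ partialSum a F)} (ℂ.trans (ℂ.+-congˡ (ℂ.-‿cong (partialSum-real a F)))
            (ℂ.trans (ℂ.+-congˡ (ℂ.sym (↑-neg _))) (ℂ.sym (↑-+ top _)))))
          (ℝ.trans (ℝ.+-congˡ (ℝ.zeroˡ 0ʳ)) (ℝ.+-identityʳ _)))

    dominated⇒summable : (∀ π → 0ʳ ≤ a π) → (∀ π → a π ≤ b π) →
                         Summable (λ π → ↑ b π) → Summable (λ π → ↑ a π)
    dominated⇒summable 0≤a a≤b (s , b⟶s) = bounded⇒summable 0≤a λ F F! →
      ℝ.≤-trans (partialSum-mono-≤ a≤b F) (partialSum≤sum (λ π → ℝ.≤-trans (0≤a π) (a≤b π)) b⟶s F!)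

  -- The quadratic form attached to the family M + α N

  -- Identities are computed in ℂ, where p, q and C live, but inequalities make sense only in ℝ;
  -- hence the real copies `a`, `b`, `r` of A, B and the form.
  record IsPencil (p q A B C : ℂ) : Set where
    field
      r    : ℂ → ℝ
      a b  : ℝ
      A≈a  : A ≈ ↑ a
      B≈b  : B ≈ ↑ b
      quadratic≈r : ∀ α → A + conj α * C + α * conj C + α * conj α * B ≈ ↑ r α
      square≤r    : ∀ α → ∣ p + α * q ∣² ≤ r α
      ∣p∣²≤a      : ∣ p ∣² ≤ a
      ∣q∣²≤b      : ∣ q ∣² ≤ b

  module PencilProperties {p q A B C : ℂ} (isPencil : IsPencil p q A B C) (pB≉0 : ¬ p * B ≈ 0ℂ)
    {D : ℂ} (D≡ : D ≡ A * B - ↑ ∣ C ∣²) where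

    open IsPencil isPencil
    open ℂ using (solve; _:=_; _:+_; _:-_; _:*_; :-_)

    p≉0 : ¬ p ≈ 0ℂ
    p≉0 p≈0 = pB≉0 (ℂ.trans (ℂ.*-congʳ p≈0) (ℂ.zeroˡ B))

    B≉0 : ¬ B ≈ 0ℂ
    B≉0 B≈0 = pB≉0 (ℂ.trans (ℂ.*-congˡ B≈0) (ℂ.zeroʳ p))

    conj-A : conj A ≈ A
    conj-A = conj-real (proj₂ A≈a)

    conj-B : conj B ≈ B
    conj-B = conj-real (proj₂ B≈b)

    0<a : 0ʳ < a
    0<a = ℝ.<-≤-trans (∣∣²-pos p≉0) ∣p∣²≤a

    0<b : 0ʳ < b
    0<b = ℝ.≤-trans (∣∣²-nonneg q) ∣q∣²≤b , λ 0≈b → B≉0 (ℂ.trans B≈b (↑-cong (ℝ.sym 0≈b)))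

    δ : ℝ
    δ = a *ʳ b -ʳ ∣ C ∣²

    D≈δ : D ≈ ↑ δ
    D≈δ = begin
      D                             ≈⟨ ℂ.reflexive D≡ ⟩
      A * B - ↑ ∣ C ∣²              ≈⟨ ℂ.+-congʳ (ℂ.*-cong A≈a B≈b) ⟩
      ↑ a * ↑ b - ↑ ∣ C ∣²          ≈⟨ ℂ.+-cong (↑-* a b) (↑-neg ∣ C ∣²) ⟨
      ↑ (a *ʳ b) + ↑ (-ʳ ∣ C ∣²)    ≈⟨ ↑-+ (a *ʳ b) (-ʳ ∣ C ∣²) ⟨
      ↑ δ                           ∎
      where open SetoidReasoning ℂ.setoid

    D≈ : D ≈ A * B - C * conj C
    D≈ = ℂ.trans (ℂ.reflexive D≡) (ℂ.+-congˡ (ℂ.-‿cong (ℂ.sym (z*conj-z C))))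

    -- Completing the square in the quadratic form.
    b*r : ∀ α → b *ʳ r α ≈ʳ ∣ α * B + C ∣² +ʳ δ
    b*r α = proj₁ (begin
      ↑ (b *ʳ r α)                                            ≈⟨ ↑-* b (r α) ⟩
      ↑ b * ↑ r α                                             ≈⟨ ℂ.*-cong B≈b (quadratic≈r α) ⟨
      B * (A + conj α * C + α * conj C + α * conj α * B)      ≈⟨ solve 6 (λ A B C C̄ α ᾱ →
        B :* (A :+ ᾱ :* C :+ α :* C̄ :+ α :* ᾱ :* B) := (α :* B :+ C) :* (ᾱ :* B :+ C̄) :+ (A :* B :- C :* C̄))
        ℂ.refl A B C (conj C) α (conj α) ⟩
      (α * B + C) * (conj α * B + conj C) + (A * B - C * conj C)
        ≈⟨ ℂ.+-cong (ℂ.*-congˡ (ℂ.sym conj[αB+C])) (ℂ.sym D≈) ⟩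
      (α * B + C) * conj (α * B + C) + D                      ≈⟨ ℂ.+-cong (z*conj-z (α * B + C)) D≈δ ⟩
      ↑ ∣ α * B + C ∣² + ↑ δ                                  ≈⟨ ↑-+ ∣ α * B + C ∣² δ ⟨
      ↑ (∣ α * B + C ∣² +ʳ δ)                                 ∎)
      where
      open SetoidReasoning ℂ.setoid
      conj[αB+C] : conj (α * B + C) ≈ conj α * B + conj C
      conj[αB+C] = ℂ.trans (conj-+ (α * B) C) (ℂ.+-congʳ (ℂ.trans (conj-* α B) (ℂ.*-congˡ conj-B)))

    -- The bound square≤r at the minimum α = - C / B of the quadratic form.
    gap≤bδ : ∣ q * C - p * B ∣² ≤ b *ʳ δ
    gap≤bδ = ℝ.≤-respˡ b²n≈ (ℝ.≤-respʳ b²r≈ (ℝ.*-monoˡ-≤ (ℝ.0≤x*x b) (square≤r α)))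
      where
      α : ℂ
      α = - C / B
      αB≈-C : α * B ≈ - C
      αB≈-C = /-*-cancel (- C) B≉0
      ∣B∣²≈b² : ∣ B ∣² ≈ʳ b *ʳ b
      ∣B∣²≈b² = ℝ.trans (∣∣²-cong B≈b) (ℝ.trans (ℝ.+-congˡ (ℝ.zeroˡ 0ʳ)) (ℝ.+-identityʳ _))
      b²n≈ : (b *ʳ b) *ʳ ∣ p + α * q ∣² ≈ʳ ∣ q * C - p * B ∣²
      b²n≈ = ℝ.trans (ℝ.*-congʳ (ℝ.sym ∣B∣²≈b²)) (ℝ.trans (ℝ.sym (∣z*t∣² B (p + α * q)))
        (ℝ.trans (∣∣²-cong B[p+αq]≈) (∣-∣²-comm (p * B) (q * C))))
        where
        B[p+αq]≈ : B * (p + α * q) ≈ p * B - q * C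
        B[p+αq]≈ = ℂ.trans
          (solve 4 (λ p q B α → B :* (p :+ α :* q) := p :* B :+ q :* (α :* B)) ℂ.refl p q B α)
          (ℂ.trans (ℂ.+-congˡ (ℂ.*-congˡ αB≈-C))
            (solve 4 (λ p q B C → p :* B :+ q :* :- C := p :* B :- q :* C) ℂ.refl p q B C))
      b²r≈ : (b *ʳ b) *ʳ r α ≈ʳ b *ʳ δ
      b²r≈ = ℝ.trans (ℝ.*-assoc b b (r α)) (ℝ.*-congˡ (ℝ.trans (b*r α)
        (ℝ.trans (ℝ.+-congʳ ∣αB+C∣²≈0) (ℝ.+-identityˡ δ))))
        where
        ∣αB+C∣²≈0 : ∣ α * B + C ∣² ≈ʳ 0ʳ
        ∣αB+C∣²≈0 = ℝ.trans (∣∣²-cong {t = 0ℂ} (ℂ.trans (ℂ.+-congʳ αB≈-C) (ℂ.-‿inverseˡ C)))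
          (ℝ.trans (ℝ.+-cong (ℝ.zeroˡ 0ʳ) (ℝ.zeroˡ 0ʳ)) (ℝ.+-identityʳ 0ʳ))

    -- The Cauchy-Schwarz inequality |C|² ≤ A B, read off from `gap≤bδ` by cancelling the positive
    -- factor `b`.
    0≤δ : 0ʳ ≤ δ
    0≤δ = ℝ.*-cancelˡ-≤ 0<b (ℝ.≤-respˡ (ℝ.sym (ℝ.zeroʳ b)) (ℝ.≤-trans (∣∣²-nonneg (q * C - p * B)) gap≤bδ))

    -- The equation β = |p + α q|² / r α with its denominator cleared; it determines β only where r
    -- α is nonzero.
    IsQuotient : ℝ → ℂ → Set
    IsQuotient β α = β *ʳ r α ≈ʳ ∣ p + α * q ∣²

    -- The case q C = p B: the quotient is constant

    module Degenerate (qC≈pB : q * C ≈ p * B) {βM βN : ℝ}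
      (βM*a : βM *ʳ a ≈ʳ ∣ p ∣²) (βN*b : βN *ʳ b ≈ʳ ∣ q ∣²) (βN≤βM : βN ≤ βM) where

      q≉0 : ¬ q ≈ 0ℂ
      q≉0 q≈0 = pB≉0 (ℂ.trans (ℂ.sym qC≈pB) (ℂ.trans (ℂ.*-congʳ q≈0) (ℂ.zeroˡ C)))

      ∣q∣²a≤∣p∣²b : ∣ q ∣² *ʳ a ≤ ∣ p ∣² *ʳ b
      ∣q∣²a≤∣p∣²b = ℝ.≤-respˡ (eq βN*b) (ℝ.≤-respʳ (ℝ.trans (ℝ.*-congʳ (ℝ.*-comm a b)) (eq βM*a))
        (ℝ.*-monoˡ-≤ (proj₁ (ℝ.*-pos 0<a 0<b)) βN≤βM))
        where
        eq : ∀ {x y u v} → x *ʳ y ≈ʳ u → v *ʳ y *ʳ x ≈ʳ u *ʳ v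
        eq {x} {y} {u} {v} xy≈u = ℝ.trans
          (ℝ.solve 3 (λ x y v → v ℝ.:* y ℝ.:* x ℝ.:= x ℝ.:* y ℝ.:* v) ℝ.refl x y v) (ℝ.*-congʳ xy≈u)

      -- Taking squared moduli in q C = p B gives |q|² |C|² = |p|² b², so |q|² δ equals b (|q|² a -
      -- |p|² b), and the left side is nonnegative.
      ∣p∣²b≤∣q∣²a : ∣ p ∣² *ʳ b ≤ ∣ q ∣² *ʳ a
      ∣p∣²b≤∣q∣²a = ℝ.*-cancelˡ-≤ 0<b (ℝ.x≈y-z∧0≤x⇒z≤y difference (ℝ.*-nonneg (∣∣²-nonneg q) 0≤δ))
        where
        ∣q∣²∣C∣²≈ : ∣ q ∣² *ʳ ∣ C ∣² ≈ʳ ∣ p ∣² *ʳ (b *ʳ b)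
        ∣q∣²∣C∣²≈ = ℝ.trans (ℝ.sym (∣z*t∣² q C)) (ℝ.trans (∣∣²-cong qC≈pB) (ℝ.trans (∣z*t∣² p B)
          (ℝ.*-congˡ (ℝ.trans (∣∣²-cong B≈b) (ℝ.trans (ℝ.+-congˡ (ℝ.zeroˡ 0ʳ)) (ℝ.+-identityʳ _))))))
        difference : ∣ q ∣² *ʳ δ ≈ʳ b *ʳ (∣ q ∣² *ʳ a) -ʳ b *ʳ (∣ p ∣² *ʳ b)
        difference = ℝ.trans
          (solveʳ 4 (λ q a b c → q :*ʳ (a :*ʳ b :-ʳ c) :=ʳ b :*ʳ (q :*ʳ a) :-ʳ q :*ʳ c) ℝ.refl ∣ q ∣² a b ∣ C ∣²)
          (ℝ.+-congˡ (ℝ.-‿cong (ℝ.trans ∣q∣²∣C∣²≈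
            (solveʳ 2 (λ p b → p :*ʳ (b :*ʳ b) :=ʳ b :*ʳ (p :*ʳ b)) ℝ.refl ∣ p ∣² b))))
          where
          open ℝ using () renaming (solve to solveʳ; _:=_ to _:=ʳ_; _:*_ to _:*ʳ_; _:-_ to _:-ʳ_)

      ∣q∣²a≈∣p∣²b : ∣ q ∣² *ʳ a ≈ʳ ∣ p ∣² *ʳ b
      ∣q∣²a≈∣p∣²b = ℝ.≤-antisym ∣q∣²a≤∣p∣²b ∣p∣²b≤∣q∣²a

      -- The quotients of M and N agree: |p|² / a = |q|² / b.
      βM*b : βM *ʳ b ≈ʳ ∣ q ∣²
      βM*b = ℝ.*-cancelˡ-≈ (ℝ.pos⇒≉0 (∣∣²-pos p≉0)) (begin
        ∣ p ∣² *ʳ (βM *ʳ b)    ≈⟨ solveʳ 3 (λ p β b → p :*ʳ (β :*ʳ b) :=ʳ β :*ʳ (p :*ʳ b)) ℝ.refl ∣ p ∣² βM b ⟩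
        βM *ʳ (∣ p ∣² *ʳ b)    ≈⟨ ℝ.*-congˡ ∣q∣²a≈∣p∣²b ⟨
        βM *ʳ (∣ q ∣² *ʳ a)    ≈⟨ solveʳ 3 (λ q β a → β :*ʳ (q :*ʳ a) :=ʳ β :*ʳ a :*ʳ q) ℝ.refl ∣ q ∣² βM a ⟩
        βM *ʳ a *ʳ ∣ q ∣²      ≈⟨ ℝ.*-congʳ βM*a ⟩
        ∣ p ∣² *ʳ ∣ q ∣²       ∎)
        where
        open SetoidReasoning ℝ.setoid
        open ℝ using () renaming (solve to solveʳ; _:=_ to _:=ʳ_; _:*_ to _:*ʳ_)

      -- After multiplication by q q̄, every occurrence of C sits in q C or q̄ C̄. Replacing these
      -- by p B and p̄ B, and |q|² A by |p|² B, leaves B times a product of conjugate factors.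
      ∣q∣²r≈ : ∀ α → ∣ q ∣² *ʳ r α ≈ʳ b *ʳ ∣ p + α * q ∣²
      ∣q∣²r≈ α = proj₁ (begin
        ↑ (∣ q ∣² *ʳ r α)                                          ≈⟨ ↑-* ∣ q ∣² (r α) ⟩
        ↑ ∣ q ∣² * ↑ r α                                           ≈⟨ ℂ.*-cong (z*conj-z q) (quadratic≈r α) ⟨
        q * conj q * (A + conj α * C + α * conj C + α * conj α * B)  ≈⟨ solve 8 (λ q q̄ A B C C̄ α ᾱ →
          q :* q̄ :* (A :+ ᾱ :* C :+ α :* C̄ :+ α :* ᾱ :* B)
          := q :* q̄ :* A :+ (q̄ :* ᾱ :* (q :* C)) :+ q :* α :* (q̄ :* C̄) :+ α :* ᾱ :* (q :* q̄) :* B)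
          ℂ.refl q (conj q) A B C (conj C) α (conj α) ⟩
        q * conj q * A + conj q * conj α * (q * C) + q * α * (conj q * conj C) + α * conj α * (q * conj q) * B
          ≈⟨ ℂ.+-congʳ (ℂ.+-cong (ℂ.+-cong qq̄A≈pp̄B (ℂ.*-congˡ qC≈pB)) (ℂ.*-congˡ q̄C̄≈p̄B)) ⟩
        p * conj p * B + conj q * conj α * (p * B) + q * α * (conj p * B) + α * conj α * (q * conj q) * B
          ≈⟨ solve 7 (λ p p̄ q q̄ B α ᾱ →
            p :* p̄ :* B :+ q̄ :* ᾱ :* (p :* B) :+ q :* α :* (p̄ :* B) :+ α :* ᾱ :* (q :* q̄) :* B
            := B :* ((p :+ α :* q) :* (p̄ :+ ᾱ :* q̄))) ℂ.refl p (conj p) q (conj q) B α (conj α) ⟩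
        B * ((p + α * q) * (conj p + conj α * conj q))
          ≈⟨ ℂ.*-cong B≈b [p+αq]conj≈ ⟩
        ↑ b * ↑ ∣ p + α * q ∣²                                     ≈⟨ ↑-* b ∣ p + α * q ∣² ⟨
        ↑ (b *ʳ ∣ p + α * q ∣²)                                    ∎)
        where
        open SetoidReasoning ℂ.setoid
        [p+αq]conj≈ : (p + α * q) * (conj p + conj α * conj q) ≈ ↑ ∣ p + α * q ∣²
        [p+αq]conj≈ = ℂ.trans
          (ℂ.*-congˡ (ℂ.sym (ℂ.trans (conj-+ p (α * q)) (ℂ.+-congˡ (conj-* α q))))) (z*conj-z (p + α * q))
        qq̄A≈pp̄B : q * conj q * A ≈ p * conj p * B
        qq̄A≈pp̄B = begin
          q * conj q * A      ≈⟨ ℂ.*-cong (z*conj-z q) A≈a ⟩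
          ↑ ∣ q ∣² * ↑ a      ≈⟨ ↑-* ∣ q ∣² a ⟨
          ↑ (∣ q ∣² *ʳ a)     ≈⟨ ↑-cong ∣q∣²a≈∣p∣²b ⟩
          ↑ (∣ p ∣² *ʳ b)     ≈⟨ ↑-* ∣ p ∣² b ⟩
          ↑ ∣ p ∣² * ↑ b      ≈⟨ ℂ.*-cong (z*conj-z p) B≈b ⟨
          p * conj p * B      ∎
        q̄C̄≈p̄B : conj q * conj C ≈ conj p * B
        q̄C̄≈p̄B = begin
          conj q * conj C     ≈⟨ conj-* q C ⟨
          conj (q * C)        ≈⟨ conj-cong qC≈pB ⟩
          conj (p * B)        ≈⟨ conj-* p B ⟩
          conj p * conj B     ≈⟨ ℂ.*-congˡ conj-B ⟩
          conj p * B          ∎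

      -- The excluded value is the only root of p + α q, a genuinely linear expression because q C =
      -- p B ≠ 0 forces q ≠ 0.
      p+αq≉0 : ∀ {α} → ¬ α ≈ - (p / q) → ¬ p + α * q ≈ 0ℂ
      p+αq≉0 {α} α≉ p+αq≈0 = α≉ (*-cancelʳ q≉0 (begin
        α * q                  ≈⟨ solve 2 (λ p t → t := :- p :+ (p :+ t)) ℂ.refl p (α * q) ⟩
        - p + (p + α * q)      ≈⟨ ℂ.+-congˡ p+αq≈0 ⟩
        - p + 0ℂ               ≈⟨ ℂ.+-identityʳ (- p) ⟩
        - p                    ≈⟨ ℂ.-‿cong (/-*-cancel p q≉0) ⟨
        - (p / q * q)          ≈⟨ solve 2 (λ s q → :- (s :* q) := :- s :* q) ℂ.refl (p / q) q ⟩
        - (p / q) * q          ∎))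
        where open SetoidReasoning ℂ.setoid

      0<r : ∀ {α} → ¬ α ≈ - (p / q) → 0ʳ < r α
      0<r {α} α≉ = ℝ.<-≤-trans (∣∣²-pos (p+αq≉0 α≉)) (square≤r α)

      quotient-constant : ∀ {α β} → ¬ α ≈ - (p / q) → IsQuotient β α → β ≈ʳ βM
      quotient-constant {α} {β} α≉ β*r =
        ℝ.*-cancelˡ-≈ (ℝ.pos⇒≉0 0<b) (ℝ.*-cancelˡ-≈ (ℝ.pos⇒≉0 (∣∣²-pos (p+αq≉0 α≉))) (begin
        n *ʳ (b *ʳ β)          ≈⟨ solveʳ 3 (λ n b β → n :*ʳ (b :*ʳ β) :=ʳ b :*ʳ n :*ʳ β) ℝ.refl n b β ⟩
        b *ʳ n *ʳ β            ≈⟨ ℝ.*-congʳ (∣q∣²r≈ α) ⟨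
        ∣ q ∣² *ʳ r α *ʳ β     ≈⟨ solveʳ 3 (λ q r β → q :*ʳ r :*ʳ β :=ʳ (β :*ʳ r) :*ʳ q) ℝ.refl ∣ q ∣² (r α) β ⟩
        (β *ʳ r α) *ʳ ∣ q ∣²   ≈⟨ ℝ.*-cong β*r (ℝ.sym βM*b) ⟩
        n *ʳ (βM *ʳ b)         ≈⟨ ℝ.*-congˡ (ℝ.*-comm βM b) ⟩
        n *ʳ (b *ʳ βM)         ∎))
        where
        open SetoidReasoning ℝ.setoid
        open ℝ using () renaming (solve to solveʳ; _:=_ to _:=ʳ_; _:*_ to _:*ʳ_)
        n : ℝ
        n = ∣ p + α * q ∣²

    -- The case q C ≠ p B: the maximum and its value

    module Nondegenerate (qC≉pB : ¬ q * C ≈ p * B) {βM : ℝ} (βM*a : βM *ʳ a ≈ʳ ∣ p ∣²) {num den V α₁ : ℂ}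
      (num≡ : num ≡ conj p * C - conj q * A) (den≡ : den ≡ conj q * conj C - conj p * B)
      (V≡ : V ≡ ↑ ∣ q ∣² * A + ↑ ∣ p ∣² * B - 2ℂ * ↑ re (conj p * q * C)) (α₁≡ : α₁ ≡ num / den) where

      num≈ : num ≈ conj p * C - conj q * A
      num≈ = ℂ.reflexive num≡

      den≈ : den ≈ conj q * conj C - conj p * B
      den≈ = ℂ.reflexive den≡

      conj-num : conj num ≈ p * conj C - q * A
      conj-num = ℂ.trans (conj-cong num≈) (ℂ.trans (conj-- (conj p * C) (conj q * A)) (ℂ.+-cong
        (ℂ.trans (conj-* (conj p) C) (ℂ.*-congʳ (conj-involutive p)))
        (ℂ.-‿cong (ℂ.trans (conj-* (conj q) A) (ℂ.*-cong (conj-involutive q) conj-A)))))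

      conj-den : conj den ≈ q * C - p * B
      conj-den = ℂ.trans (conj-cong den≈) (ℂ.trans (conj-- (conj q * conj C) (conj p * B)) (ℂ.+-cong
        (ℂ.trans (conj-* (conj q) (conj C)) (ℂ.*-cong (conj-involutive q) (conj-involutive C)))
        (ℂ.-‿cong (ℂ.trans (conj-* (conj p) B) (ℂ.*-cong (conj-involutive p) conj-B)))))

      V≈ : V ≈ q * conj q * A + p * conj p * B - (conj p * q * C + p * conj q * conj C)
      V≈ = ℂ.trans (ℂ.reflexive V≡)
        (ℂ.+-cong (ℂ.+-cong (ℂ.*-congʳ (ℂ.sym (z*conj-z q))) (ℂ.*-congʳ (ℂ.sym (z*conj-z p))))
        (ℂ.-‿cong (ℂ.trans (ℂ.sym (re+re (conj p * q * C))) (ℂ.+-congˡ (ℂ.trans (conj-* (conj p * q) C)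
          (ℂ.*-congʳ (ℂ.trans (conj-* (conj p) q) (ℂ.*-congʳ (conj-involutive p)))))))))

      x-y≈0⇒x≈y : ∀ {x y} → x - y ≈ 0ℂ → x ≈ y
      x-y≈0⇒x≈y {x} {y} x-y≈0 = ℂ.trans (solve 2 (λ x y → x := (x :- y) :+ y) ℂ.refl x y)
        (ℂ.trans (ℂ.+-congʳ x-y≈0) (ℂ.+-identityˡ y))

      -- The conjugate of `den` is q C - p B, so the case assumption says exactly that α₁ has a
      -- nonzero denominator.
      den≉0 : ¬ den ≈ 0ℂ
      den≉0 den≈0 = qC≉pB (x-y≈0⇒x≈y (ℂ.trans (ℂ.sym conj-den) (ℂ.trans (conj-cong den≈0) (conj-real ℝ.refl))))

      0<δ : 0ʳ < δ
      0<δ = ℝ.*-cancelˡ-pos 0<b (ℝ.<-≤-trans (∣∣²-pos λ qC-pB≈0 → qC≉pB (x-y≈0⇒x≈y qC-pB≈0)) gap≤bδ)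

      D-positive : Positive D
      D-positive = proj₂ D≈δ , ℝ.<-resp-≈ ℝ.refl (ℝ.sym (proj₁ D≈δ)) 0<δ

      AD≈aδ : A * D ≈ ↑ (a *ʳ δ)
      AD≈aδ = ℂ.trans (ℂ.*-cong A≈a D≈δ) (ℂ.sym (↑-* a δ))

      AD-positive : Positive (A * D)
      AD-positive = proj₂ AD≈aδ , ℝ.<-resp-≈ ℝ.refl (ℝ.sym (proj₁ AD≈aδ)) (ℝ.*-pos 0<a 0<δ)

      positive⇒≉0 : ∀ {z} → Positive z → ¬ z ≈ 0ℂ
      positive⇒≉0 (_ , 0<re) (re≈0 , _) = ℝ.pos⇒≉0 0<re re≈0

      D≉0 : ¬ D ≈ 0ℂ
      D≉0 = positive⇒≉0 D-positive

      -- By the completed square, b r α ≥ δ > 0. The bound holds for all α, including the zero of p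
      -- + α q, where `square≤r` alone gives no strictness.
      0<r : ∀ α → 0ʳ < r α
      0<r α = ℝ.*-cancelˡ-pos 0<b (ℝ.<-resp-≈ ℝ.refl (ℝ.sym (b*r α))
        (ℝ.<-≤-trans 0<δ (ℝ.≤-respˡ (ℝ.+-identityˡ δ) (ℝ.+-mono-≤ (∣∣²-nonneg (α * B + C)) ℝ.≤-refl))))

      -- The case α = 0 of `V*quadratic`, with the vanishing terms removed.
      V*A : V * A ≈ D * ↑ ∣ p ∣² + ↑ ∣ num ∣²
      V*A = begin
        V * A
          ≈⟨ ℂ.*-congʳ V≈ ⟩
        (q * conj q * A + p * conj p * B - (conj p * q * C + p * conj q * conj C)) * A
          ≈⟨ solve 8 (λ p p̄ q q̄ A B C C̄ →
               (q :* q̄ :* A :+ p :* p̄ :* B :- (p̄ :* q :* C :+ p :* q̄ :* C̄)) :* A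
               := (A :* B :- C :* C̄) :* (p :* p̄) :+ (p̄ :* C :- q̄ :* A) :* (p :* C̄ :- q :* A))
               ℂ.refl p (conj p) q (conj q) A B C (conj C) ⟩
        (A * B - C * conj C) * (p * conj p) + (conj p * C - conj q * A) * (p * conj C - q * A)
          ≈⟨ ℂ.+-cong (ℂ.*-cong D≈ (ℂ.sym (z*conj-z p))) (ℂ.trans (ℂ.sym (z*conj-z num)) (ℂ.*-cong num≈ conj-num)) ⟨
        D * ↑ ∣ p ∣² + ↑ ∣ num ∣² ∎
        where open SetoidReasoning ℂ.setoid

      -- Lagrange's identity for the Gram form and its adjugate. The remainder vanishes exactly when
      -- α `den` = `num`, which explains the choice of α₁.
      V*quadratic : ∀ α → V * (A + conj α * C + α * conj C + α * conj α * B)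
                          ≈ D * ↑ ∣ p + α * q ∣² + ↑ ∣ α * den - num ∣²
      V*quadratic α = begin
        V * (A + conj α * C + α * conj C + α * conj α * B)
          ≈⟨ ℂ.*-congʳ V≈ ⟩
        (q * conj q * A + p * conj p * B - (conj p * q * C + p * conj q * conj C))
          * (A + conj α * C + α * conj C + α * conj α * B)
          ≈⟨ solve 10 (λ p p̄ q q̄ A B C C̄ α ᾱ →
               (q :* q̄ :* A :+ p :* p̄ :* B :- (p̄ :* q :* C :+ p :* q̄ :* C̄))
                 :* (A :+ ᾱ :* C :+ α :* C̄ :+ α :* ᾱ :* B)
               := (A :* B :- C :* C̄) :* ((p :+ α :* q) :* (p̄ :+ ᾱ :* q̄))
                  :+ (α :* (q̄ :* C̄ :- p̄ :* B) :- (p̄ :* C :- q̄ :* A))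
                     :* (ᾱ :* (q :* C :- p :* B) :- (p :* C̄ :- q :* A)))
               ℂ.refl p (conj p) q (conj q) A B C (conj C) α (conj α) ⟩
        (A * B - C * conj C) * ((p + α * q) * (conj p + conj α * conj q))
          + (α * (conj q * conj C - conj p * B) - (conj p * C - conj q * A))
            * (conj α * (q * C - p * B) - (p * conj C - q * A))
          ≈⟨ ℂ.+-cong
               (ℂ.*-cong D≈ (ℂ.trans (ℂ.sym (z*conj-z (p + α * q)))
                 (ℂ.*-congˡ (ℂ.trans (conj-+ p (α * q)) (ℂ.+-congˡ (conj-* α q))))))
               (ℂ.trans (ℂ.sym (z*conj-z (α * den - num))) (ℂ.*-cong
                 (ℂ.+-cong (ℂ.*-congˡ den≈) (ℂ.-‿cong num≈)) (ℂ.trans (conj-- (α * den) num)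
                 (ℂ.+-cong (ℂ.trans (conj-* α den) (ℂ.*-congˡ conj-den)) (ℂ.-‿cong conj-num))))) ⟨
        D * ↑ ∣ p + α * q ∣² + ↑ ∣ α * den - num ∣² ∎
        where open SetoidReasoning ℂ.setoid

      -- Both sides are compared after multiplication by A D, where the claim becomes `V*A`: the
      -- term D |p|² yields βM and the square yields the gain over it.
      value₁≈value₂ : V / D ≈ ↑ βM + ↑ ∣ num ∣² / (A * D)
      value₁≈value₂ = *-cancelʳ (positive⇒≉0 AD-positive) (begin
        V / D * (A * D)
          ≈⟨ solve 3 (λ v A D → v :* (A :* D) := (v :* D) :* A) ℂ.refl (V / D) A D ⟩
        V / D * D * A
          ≈⟨ ℂ.*-congʳ (/-*-cancel V D≉0) ⟩
        V * A
          ≈⟨ V*A ⟩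
        D * ↑ ∣ p ∣² + ↑ ∣ num ∣²
          ≈⟨ ℂ.+-cong (ℂ.*-congˡ βM*A) (/-*-cancel (↑ ∣ num ∣²) (positive⇒≉0 AD-positive)) ⟨
        D * (↑ βM * A) + ↑ ∣ num ∣² / (A * D) * (A * D)
          ≈⟨ solve 4 (λ β x A D → D :* (β :* A) :+ x :* (A :* D) := (β :+ x) :* (A :* D))
               ℂ.refl (↑ βM) (↑ ∣ num ∣² / (A * D)) A D ⟩
        (↑ βM + ↑ ∣ num ∣² / (A * D)) * (A * D)               ∎)
        where
        open SetoidReasoning ℂ.setoid
        βM*A : ↑ βM * A ≈ ↑ ∣ p ∣²
        βM*A = ℂ.trans (ℂ.*-congˡ A≈a) (ℂ.trans (ℂ.sym (↑-* βM a)) (↑-cong βM*a))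

      V*r : ∀ {α β} → IsQuotient β α → V * ↑ r α ≈ ↑ (δ *ʳ (β *ʳ r α) +ʳ ∣ α * den - num ∣²)
      V*r {α} {β} β*r = begin
        V * ↑ r α                                               ≈⟨ ℂ.*-congˡ (quadratic≈r α) ⟨
        V * (A + conj α * C + α * conj C + α * conj α * B)                                   ≈⟨ V*quadratic α ⟩
        D * ↑ ∣ p + α * q ∣² + ↑ ∣ α * den - num ∣²             ≈⟨ ℂ.+-congʳ (ℂ.*-cong D≈δ (↑-cong (ℝ.sym β*r))) ⟩
        ↑ δ * ↑ (β *ʳ r α) + ↑ ∣ α * den - num ∣²               ≈⟨ ℂ.+-congʳ (↑-* δ (β *ʳ r α)) ⟨
        ↑ (δ *ʳ (β *ʳ r α)) + ↑ ∣ α * den - num ∣²              ≈⟨ ↑-+ (δ *ʳ (β *ʳ r α)) ∣ α * den - num ∣² ⟨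
        ↑ (δ *ʳ (β *ʳ r α) +ʳ ∣ α * den - num ∣²)               ∎
        where open SetoidReasoning ℂ.setoid

      α₁*den≈num : α₁ * den ≈ num
      α₁*den≈num = ℂ.trans (ℂ.*-congʳ (ℂ.reflexive α₁≡)) (/-*-cancel num den≉0)

      module _ {β₁ : ℝ} (β₁*r : IsQuotient β₁ α₁) where

        -- At α₁ the square in `V*r` is zero, and the positive factor r α₁ cancels. In particular V
        -- is real.
        V≈δβ₁ : V ≈ ↑ (δ *ʳ β₁)
        V≈δβ₁ = *-cancelʳ {z = ↑ r α₁} (λ (r≈0 , _) → ℝ.pos⇒≉0 (0<r α₁) r≈0) (begin
          V * ↑ r α₁                                                     ≈⟨ V*r β₁*r ⟩
          ↑ (δ *ʳ (β₁ *ʳ r α₁) +ʳ ∣ α₁ * den - num ∣²)            ≈⟨ ↑-cong (ℝ.+-congˡ ∣num-num∣²≈0) ⟩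
          ↑ (δ *ʳ (β₁ *ʳ r α₁) +ʳ 0ʳ)                                    ≈⟨ ↑-cong (ℝ.+-identityʳ _) ⟩
          ↑ (δ *ʳ (β₁ *ʳ r α₁))                                          ≈⟨ ↑-cong (ℝ.*-assoc δ β₁ _) ⟨
          ↑ (δ *ʳ β₁ *ʳ r α₁)                                            ≈⟨ ↑-* (δ *ʳ β₁) (r α₁) ⟩
          ↑ (δ *ʳ β₁) * ↑ r α₁                                           ∎)
          where
          open SetoidReasoning ℂ.setoid
          ∣num-num∣²≈0 : ∣ α₁ * den - num ∣² ≈ʳ 0ʳ
          ∣num-num∣²≈0 = ℝ.trans
            (∣∣²-cong {t = 0ℂ} (ℂ.trans (ℂ.+-congʳ α₁*den≈num) (ℂ.-‿inverseʳ num)))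
            (ℝ.trans (ℝ.+-cong (ℝ.zeroˡ 0ʳ) (ℝ.zeroˡ 0ʳ)) (ℝ.+-identityʳ 0ʳ))

        maximum≈value₁ : ↑ β₁ ≈ V / D
        maximum≈value₁ = *≈⇒≈/ D≉0 (begin
          ↑ β₁ * D          ≈⟨ ℂ.*-comm (↑ β₁) D ⟩
          D * ↑ β₁          ≈⟨ ℂ.*-congʳ D≈δ ⟩
          ↑ δ * ↑ β₁        ≈⟨ ↑-* δ β₁ ⟨
          ↑ (δ *ʳ β₁)       ≈⟨ V≈δβ₁ ⟨
          V                 ∎)
          where open SetoidReasoning ℂ.setoid

        -- Subtracting the quotient equation for β from `V≈δβ₁` scaled by r α gives δ (r α) (β₁ - β)
        -- = |α `den` - `num`|².
        quotient≤maximum : ∀ {α β} → IsQuotient β α → β ≤ β₁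
        quotient≤maximum {α} {β} β*r = ℝ.*-cancelˡ-≤ (ℝ.*-pos 0<δ (0<r α))
          (ℝ.x≈y-z∧0≤x⇒z≤y difference (∣∣²-nonneg (α * den - num)))
          where
          open ℝ using () renaming (solve to solveʳ; _:=_ to _:=ʳ_; _:*_ to _:*ʳ_; _:-_ to _:-ʳ_; _:+_ to _:+ʳ_)
          s : ℝ
          s = ∣ α * den - num ∣²
          δβ₁r≈ : δ *ʳ β₁ *ʳ r α ≈ʳ δ *ʳ (β *ʳ r α) +ʳ s
          δβ₁r≈ = proj₁ (ℂ.trans (↑-* (δ *ʳ β₁) (r α)) (ℂ.trans (ℂ.*-congʳ (ℂ.sym V≈δβ₁)) (V*r β*r)))
          difference : s ≈ʳ δ *ʳ r α *ʳ β₁ -ʳ δ *ʳ r α *ʳ β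
          difference = begin
            s
              ≈⟨ solveʳ 4 (λ s δ β r → s :=ʳ (δ :*ʳ (β :*ʳ r) :+ʳ s) :-ʳ δ :*ʳ r :*ʳ β) ℝ.refl s δ β (r α) ⟩
            (δ *ʳ (β *ʳ r α) +ʳ s) -ʳ δ *ʳ r α *ʳ β
              ≈⟨ ℝ.+-congʳ δβ₁r≈ ⟨
            δ *ʳ β₁ *ʳ r α -ʳ δ *ʳ r α *ʳ β
              ≈⟨ ℝ.+-congʳ (solveʳ 3 (λ δ β r → δ :*ʳ β :*ʳ r :=ʳ δ :*ʳ r :*ʳ β) ℝ.refl δ β₁ (r α)) ⟩
            δ *ʳ r α *ʳ β₁ -ʳ δ *ʳ r α *ʳ β                ∎
            where open SetoidReasoning ℝ.setoid

  -- num, den, V, D and α₁ are parameters with propositional equations rather than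
  -- definitions: _≈_ unfolds to real and imaginary parts, and conversion would
  -- otherwise expand the whole of p + α₁ q.
  record QuotientData (p q A B C : ℂ) (P Q : ℂ → ℂ) (βM βN : ℝ) (β : ℂ → ℝ) (num den V D α₁ : ℂ) : Set where
    field
      num≡   : num ≡ conj p * C - conj q * A
      den≡   : den ≡ conj q * conj C - conj p * B
      V≡     : V ≡ ↑ ∣ q ∣² * A + ↑ ∣ p ∣² * B - 2ℂ * ↑ re (conj p * q * C)
      D≡     : D ≡ A * B - ↑ ∣ C ∣²
      α₁≡    : α₁ ≡ num / den
      A-real : im A ≈ʳ 0ʳ
      B-real : im B ≈ʳ 0ʳ
      Q-real : ∀ α → im (Q α) ≈ʳ 0ʳ
      P≈     : ∀ α → P α ≈ p + α * q
      Q≈     : ∀ α → Q α ≈ A + conj α * C + α * conj C + α * conj α * B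
      ∣p∣²≤A : ∣ p ∣² ≤ re A
      ∣q∣²≤B : ∣ q ∣² ≤ re B
      ∣P∣²≤Q : ∀ α → ∣ P α ∣² ≤ re (Q α)
      βM*A   : 0ʳ < re A → βM *ʳ re A ≈ʳ ∣ p ∣²
      βN*B   : 0ʳ < re B → βN *ʳ re B ≈ʳ ∣ q ∣²
      β*Q    : ∀ α → 0ʳ < re (Q α) → β α *ʳ re (Q α) ≈ʳ ∣ P α ∣²

  module _ {p q A B C : ℂ} {P Q : ℂ → ℂ} {βM βN : ℝ} {β : ℂ → ℝ} {num den V D α₁ : ℂ}
    (quotientData : QuotientData p q A B C P Q βM βN β num den V D α₁) (pB≉0 : ¬ p * B ≈ 0ℂ) where

    open QuotientData quotientData

    isPencil : IsPencil p q A B C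
    isPencil = record
      { r           = λ α → re (Q α)
      ; a           = re A
      ; b           = re B
      ; A≈a         = real⇒↑re A-real
      ; B≈b         = real⇒↑re B-real
      ; quadratic≈r = λ α → ℂ.trans (ℂ.sym (Q≈ α)) (real⇒↑re (Q-real α))
      ; square≤r    = λ α → ℝ.≤-respˡ (∣∣²-cong (P≈ α)) (∣P∣²≤Q α)
      ; ∣p∣²≤a      = ∣p∣²≤A
      ; ∣q∣²≤b      = ∣q∣²≤B
      }

    open PencilProperties isPencil pB≉0 D≡

    isQuotient : ∀ α → 0ʳ < re (Q α) → IsQuotient (β α) α
    isQuotient α 0<Q = ℝ.trans (β*Q α 0<Q) (∣∣²-cong (P≈ α))

    degenerate-case : βN ≤ βM → q * C ≈ p * B → ∀ α → ¬ α ≈ - (p / q) → β α ≈ʳ βM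
    degenerate-case βN≤βM qC≈pB α α≉ = quotient-constant α≉ (isQuotient α (0<r α≉))
      where open Degenerate qC≈pB (βM*A 0<a) (βN*B 0<b) βN≤βM

    nondegenerate-case : ¬ q * C ≈ p * B →
      (∀ α → β α ≤ β α₁) × (↑ β α₁ ≈ V / D) × (V / D ≈ ↑ βM + ↑ ∣ num ∣² / (A * D))
      × Positive D × Positive (A * D)
    nondegenerate-case qC≉pB =
      (λ α → quotient≤maximum {β α₁} β₁*r {α} {β α} (isQuotient α (0<r α))) ,
      maximum≈value₁ {β α₁} β₁*r , value₁≈value₂ , D-positive , AD-positive
      where
      open Nondegenerate qC≉pB {βM} (βM*A 0<a) {num} {den} {V} {α₁} num≡ den≡ V≡ α₁≡
      β₁*r : IsQuotient (β α₁) α₁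
      β₁*r = isQuotient α₁ (0<r α₁)

  -- Weighted means and square-summable functions

  module _ {G : Set g} (L : G → ℂ) (w : G → ℝ) where

    open Weighted L w

    module WeightedMean
      (0≤w : ∀ π → 0ʳ ≤ w π) (w≢0 : ¬ (∀ π → w π ≈ʳ 0ʳ)) (w-summable : Summable (λ π → ↑ w π))
      where

      open Series {G}

      private variable
        f h : G → ℂ
        a : G → ℝ
        m n : ℂ

      hasSum-resp : ∀ {s t} → s ≈ t → HasSum f s → HasSum f t
      hasSum-resp s≈t f⟶s ε 0<ε =
        let F , close = f⟶s ε 0<ε
        in F , λ F′ F′! F⊆F′ →
          ℝ.<-resp-≈ (∣∣²-cong (ℂ.+-congˡ (ℂ.-‿cong s≈t))) ℝ.refl (close F′ F′! F⊆F′)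

      totalWeight : ℝ
      totalWeight = re (proj₁ w-summable)

      w⟶totalWeight : HasSum (λ π → ↑ w π) (↑ totalWeight)
      w⟶totalWeight = hasSum-resp (real⇒↑re (hasSum-real (proj₂ w-summable))) (proj₂ w-summable)

      -- By excluded middle some weight is nonzero, and the partial sum over that single index
      -- already bounds the total from below.
      totalWeight-pos : 0ʳ < totalWeight
      totalWeight-pos with em {∃[ π ] ¬ w π ≈ʳ 0ʳ}
      ... | yes (π , wπ≉0) = ℝ.<-≤-trans (0≤w π , λ 0≈wπ → wπ≉0 (ℝ.sym 0≈wπ))
        (ℝ.≤-respˡ (ℝ.+-identityʳ (w π)) (partialSum≤sum {F = π ∷ []} 0≤w w⟶totalWeight (All.[] ∷ [])))
      ... | no none = contradiction w≈0 w≢0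
        where
        w≈0 : ∀ π → w π ≈ʳ 0ʳ
        w≈0 π with decide (w π ≈ʳ 0ʳ)
        ... | yes wπ≈0 = wπ≈0
        ... | no wπ≉0  = contradiction (π , wπ≉0) none

      totalWeight≉0 : ¬ ↑ totalWeight ≈ 0ℂ
      totalWeight≉0 (re≈0 , _) = ℝ.pos⇒≉0 totalWeight-pos re≈0

      -- A mean with its denominator cleared and without the choice hidden in `∑`, so that linearity
      -- and conjugation carry over from `HasSum`; `𝔼≈` translates back.
      HasMean : (G → ℂ) → ℂ → Set g
      HasMean f m = HasSum (λ π → ↑ w π * f π) (m * ↑ totalWeight)

      𝔼≈ : HasMean f m → 𝔼 f ≈ m
      𝔼≈ {f} {m} f⟶m = ℂ.sym (*≈⇒≈/ ∑w≉0 (ℂ.trans (ℂ.*-congˡ ∑w≈) (ℂ.sym (∑≈ f⟶m))))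
        where
        ∑w≈ : ∑ (λ π → ↑ w π) ≈ ↑ totalWeight
        ∑w≈ = ∑≈ w⟶totalWeight
        ∑w≉0 : ¬ ∑ (λ π → ↑ w π) ≈ 0ℂ
        ∑w≉0 ∑w≈0 = totalWeight≉0 (ℂ.trans (ℂ.sym ∑w≈) ∑w≈0)

      summable⇒hasMean-𝔼 : Summable (λ π → ↑ w π * f π) → HasMean f (𝔼 f)
      summable⇒hasMean-𝔼 {f} (s , f⟶s) = hasSum-resp (ℂ.*-congʳ (ℂ.sym (𝔼≈ f⟶m))) f⟶m
        where
        f⟶m : HasMean f (s / ↑ totalWeight)
        f⟶m = hasSum-resp (ℂ.sym (/-*-cancel s totalWeight≉0)) f⟶s

      mean-cong : (∀ π → f π ≈ h π) → HasMean f m → HasMean h m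
      mean-cong f≈h = hasSum-cong (λ π → ℂ.*-congˡ (f≈h π))

      mean-+ : HasMean f m → HasMean h n → HasMean (λ π → f π + h π) (m + n)
      mean-+ {f} {m} {h} {n} f⟶m h⟶n = hasSum-resp (ℂ.sym (ℂ.distribʳ (↑ totalWeight) m n))
        (hasSum-cong (λ π → ℂ.sym (ℂ.distribˡ (↑ w π) (f π) (h π))) (hasSum-+ f⟶m h⟶n))

      mean-* : ∀ c → HasMean f m → HasMean (λ π → c * f π) (c * m)
      mean-* {f} {m} c f⟶m = hasSum-resp (ℂ.sym (ℂ.*-assoc c m (↑ totalWeight)))
        (hasSum-cong (λ π → swap c (↑ w π) (f π)) (hasSum-* c f⟶m))
        where
        open ℂ using (solve; _:=_; _:*_)
        swap : ∀ x y z → x * (y * z) ≈ y * (x * z)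
        swap = solve 3 (λ x y z → x :* (y :* z) := y :* (x :* z)) ℂ.refl

      mean-conj : HasMean f m → HasMean (λ π → conj (f π)) (conj m)
      mean-conj {f} {m} f⟶m = hasSum-resp (conj-scale m totalWeight)
        (hasSum-cong (λ π → ℂ.trans (conj-* (↑ w π) (f π)) (ℂ.*-congʳ (conj-real ℝ.refl))) (hasSum-conj f⟶m))
        where
        conj-scale : ∀ z x → conj (z * ↑ x) ≈ conj z * ↑ x
        conj-scale z x = ℂ.trans (conj-* z (↑ x)) (ℂ.*-congˡ (conj-real ℝ.refl))

      mean-1 : HasMean (λ _ → ↑ 1ʳ) (↑ 1ʳ)
      mean-1 = hasSum-resp (ℂ.sym (ℂ.*-identityˡ (↑ totalWeight)))
        (hasSum-cong (λ π → ℂ.sym (ℂ.*-identityʳ (↑ w π))) w⟶totalWeight)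

      mean-real : HasMean (λ π → ↑ a π) m → im m ≈ʳ 0ʳ
      mean-real a⟶m = conj-fixed⇒real (*-cancelʳ totalWeight≉0
        (hasSum-unique (mean-cong (λ π → conj-real ℝ.refl) (mean-conj a⟶m)) a⟶m))

      mean-nonneg : (∀ π → 0ʳ ≤ a π) → HasMean (λ π → ↑ a π) m → 0ʳ ≤ re m
      mean-nonneg {a} {m} 0≤a a⟶m = ℝ.*-cancelˡ-≤ totalWeight-pos
        (ℝ.≤-respˡ (ℝ.sym (ℝ.zeroʳ totalWeight)) (ℝ.≤-respʳ re[mW] (sum-nonneg (λ π → ℝ.*-nonneg (0≤w π) (0≤a π))
          (hasSum-cong (λ π → ℂ.sym (↑-* (w π) (a π))) a⟶m))))
        where
        re[mW] : re (m * ↑ totalWeight) ≈ʳ totalWeight *ʳ re m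
        re[mW] = proj₁ (ℂ.trans (ℂ.*-comm m (↑ totalWeight)) (↑-scale totalWeight m))

      SquareSummable : (G → ℂ) → Set g
      SquareSummable f = Summable (λ π → ↑ (w π *ʳ ∣ f π ∣²))

      squareSummable-cong : (∀ π → f π ≈ h π) → SquareSummable f → SquareSummable h
      squareSummable-cong f≈h (s , f⟶s) =
        s , hasSum-cong (λ π → ↑-cong (ℝ.*-congˡ (∣∣²-cong (f≈h π)))) f⟶s

      squareSummable-1 : SquareSummable (λ _ → ↑ 1ʳ)
      squareSummable-1 = ↑ totalWeight , hasSum-cong (λ π → ↑-cong (ℝ.sym (w*1 (w π)))) w⟶totalWeight
        where
        w*1 : ∀ x → x *ʳ ∣ ↑ 1ʳ ∣² ≈ʳ x
        w*1 x = ℝ.trans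
          (ℝ.*-congˡ (ℝ.trans (ℝ.+-cong (ℝ.*-identityˡ 1ʳ) (ℝ.zeroˡ 0ʳ)) (ℝ.+-identityʳ 1ʳ))) (ℝ.*-identityʳ x)

      squareSummable-* : ∀ c → SquareSummable f → SquareSummable (λ π → c * f π)
      squareSummable-* {f} c (s , f⟶s) = ↑ ∣ c ∣² * s ,
        hasSum-cong (λ π → pointwise (w π) (f π)) (hasSum-* (↑ ∣ c ∣²) f⟶s)
        where
        open ℝ using (solve; _:=_; _:*_)
        pointwise : ∀ x z → ↑ ∣ c ∣² * ↑ (x *ʳ ∣ z ∣²) ≈ ↑ (x *ʳ ∣ c * z ∣²)
        pointwise x z = ℂ.trans (ℂ.sym (↑-* _ _)) (↑-cong (ℝ.trans
          (solve 3 (λ c x z → c :* (x :* z) := x :* (c :* z)) ℝ.refl ∣ c ∣² x ∣ z ∣²)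
          (ℝ.*-congˡ (ℝ.sym (∣z*t∣² c z)))))

      squareSummable-+ : SquareSummable f → SquareSummable h → SquareSummable (λ π → f π + h π)
      squareSummable-+ {f} {h} (s , f⟶s) (t , h⟶t) = dominated⇒summable
        (λ π → ℝ.*-nonneg (0≤w π) (∣∣²-nonneg (f π + h π)))
        (λ π → ℝ.*-monoˡ-≤ (0≤w π) (parallelogram (f π) (h π)))
        ( (s + t) + (s + t)
        , hasSum-cong (λ π → pointwise (w π) ∣ f π ∣² ∣ h π ∣²) (hasSum-+ (hasSum-+ f⟶s h⟶t) (hasSum-+ f⟶s h⟶t)))
        where
        pointwise : ∀ x y z → (↑ (x *ʳ y) + ↑ (x *ʳ z)) + (↑ (x *ʳ y) + ↑ (x *ʳ z)) ≈ ↑ (x *ʳ ((y +ʳ z) +ʳ (y +ʳ z)))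
        pointwise x y z =
          ℝ.solve 3 (λ x y z → (x ℝ.:* y ℝ.:+ x ℝ.:* z) ℝ.:+ (x ℝ.:* y ℝ.:+ x ℝ.:* z)
            ℝ.:= x ℝ.:* ((y ℝ.:+ z) ℝ.:+ (y ℝ.:+ z))) ℝ.refl x y z ,
          ℝ.trans (ℝ.+-cong (ℝ.+-identityʳ 0ʳ) (ℝ.+-identityʳ 0ʳ)) (ℝ.+-identityʳ 0ʳ)

      private
        𝕚 : ℂ
        𝕚 = 0ʳ +i 1ʳ

        1+𝕚²≈0 : ↑ 1ʳ + 𝕚 * 𝕚 ≈ 0ℂ
        1+𝕚²≈0 =
          solve 0 (con (+ 1) :+ (con (+ 0) :* con (+ 0) :- con (+ 1) :* con (+ 1)) := con (+ 0)) ℝ.refl ,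
          solve 0 (con (+ 0) :+ (con (+ 0) :* con (+ 1) :+ con (+ 1) :* con (+ 0)) := con (+ 0)) ℝ.refl
          where open ℝ using (solve; _:=_; _:+_; _:-_; _:*_; con)

        conj-𝕚 : conj 𝕚 ≈ - 𝕚
        conj-𝕚 = ℝ.sym ℝ.-0#≈0# , ℝ.refl

        ½ : ℝ
        ½ = proj₁ (ℝ.divide (ℝ.+-pos ℝ.0<1 (proj₁ ℝ.0<1)) ℝ.0<1)

        z+z≈t⇒z≈½t : ∀ {z t} → t ≈ z + z → ↑ ½ * t ≈ z
        z+z≈t⇒z≈½t {z} {t} t≈z+z = begin
          ↑ ½ * t                      ≈⟨ ℂ.*-congˡ t≈z+z ⟩
          ↑ ½ * (z + z)                ≈⟨ solve 2 (λ h z → h :* (z :+ z) := (h :+ h) :* z) ℂ.refl (↑ ½) z ⟩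
          (↑ ½ + ↑ ½) * z              ≈⟨ ℂ.*-congʳ (↑-+ ½ ½) ⟨
          ↑ (½ +ʳ ½) * z               ≈⟨ ℂ.*-congʳ (↑-cong ½+½≈1) ⟩
          ↑ 1ʳ * z                     ≈⟨ ℂ.*-identityˡ z ⟩
          z                            ∎
          where
          open SetoidReasoning ℂ.setoid
          open ℂ using (solve; _:=_; _:+_; _:*_)
          ½+½≈1 : ½ +ʳ ½ ≈ʳ 1ʳ
          ½+½≈1 = ℝ.trans (ℝ.sym (ℝ.trans (ℝ.distribʳ ½ 1ʳ 1ʳ) (ℝ.+-cong (ℝ.*-identityˡ ½) (ℝ.*-identityˡ ½))))
            (proj₂ (proj₂ (ℝ.divide (ℝ.+-pos ℝ.0<1 (proj₁ ℝ.0<1)) ℝ.0<1)))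

      -- The cross terms of |z + t|² are z t̄ + z̄ t, those of 𝕚 |z + 𝕚 t|² are z t̄ - z̄ t, so
      -- together they give 2 z t̄. The factor - (1 + 𝕚) removes the pure squares.
      polarisation : ∀ x z t →
        ↑ (x *ʳ ∣ z + t ∣²) + 𝕚 * ↑ (x *ʳ ∣ z + 𝕚 * t ∣²) + (- (↑ 1ʳ + 𝕚)) * (↑ (x *ʳ ∣ z ∣²) + ↑ (x *ʳ ∣ t ∣²))
        ≈ ↑ x * (z * conj t) + ↑ x * (z * conj t)
      polarisation x z t = begin
        ↑ (x *ʳ ∣ z + t ∣²) + 𝕚 * ↑ (x *ʳ ∣ z + 𝕚 * t ∣²) + (- (↑ 1ʳ + 𝕚)) * (↑ (x *ʳ ∣ z ∣²) + ↑ (x *ʳ ∣ t ∣²))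
          ≈⟨ ℂ.+-cong
               (ℂ.+-cong (ℂ.trans (expand (z + t)) (ℂ.*-congˡ (ℂ.*-congˡ (conj-+ z t))))
                         (ℂ.*-congˡ (ℂ.trans (expand (z + 𝕚 * t)) (ℂ.*-congˡ (ℂ.*-congˡ conj[z+𝕚t])))))
               (ℂ.*-congˡ (ℂ.+-cong (expand z) (expand t))) ⟩
        ↑ x * ((z + t) * (conj z + conj t)) + 𝕚 * (↑ x * ((z + 𝕚 * t) * (conj z + - 𝕚 * conj t)))
          + (- (↑ 1ʳ + 𝕚)) * (↑ x * (z * conj z) + ↑ x * (t * conj t))
          -- To the solver 𝕚 is just a variable, so the error of the formula is exhibited as a
          -- multiple of 1 + 𝕚², which vanishes in the next step.
          ≈⟨ solve 6 (λ x z z̄ t t̄ i →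
               x :* ((z :+ t) :* (z̄ :+ t̄)) :+ i :* (x :* ((z :+ i :* t) :* (z̄ :+ :- i :* t̄)))
                 :+ (:- (con (+ 1) :+ i)) :* (x :* (z :* z̄) :+ x :* (t :* t̄))
               := (x :* (z :* t̄) :+ x :* (z :* t̄))
                    :+ (con (+ 1) :+ i :* i) :* (x :* (t :* z̄ :- z :* t̄ :- i :* t :* t̄)))
               ℂ.refl (↑ x) z (conj z) t (conj t) 𝕚 ⟩
        (↑ x * (z * conj t) + ↑ x * (z * conj t)) + (↑ 1ʳ + 𝕚 * 𝕚) * (↑ x * (t * conj z - z * conj t - 𝕚 * t * conj t))
          ≈⟨ ℂ.+-congˡ (ℂ.trans (ℂ.*-congʳ 1+𝕚²≈0) (ℂ.zeroˡ _)) ⟩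
        (↑ x * (z * conj t) + ↑ x * (z * conj t)) + 0ℂ
          ≈⟨ ℂ.+-identityʳ _ ⟩
        ↑ x * (z * conj t) + ↑ x * (z * conj t) ∎
        where
        open SetoidReasoning ℂ.setoid
        open ℂ using (solve; _:=_; _:+_; _:-_; _:*_; :-_; con)
        expand : ∀ u → ↑ (x *ʳ ∣ u ∣²) ≈ ↑ x * (u * conj u)
        expand u = ℂ.trans (↑-* x ∣ u ∣²) (ℂ.*-congˡ (ℂ.sym (z*conj-z u)))
        conj[z+𝕚t] : conj (z + 𝕚 * t) ≈ conj z + - 𝕚 * conj t
        conj[z+𝕚t] = ℂ.trans (conj-+ z (𝕚 * t)) (ℂ.+-congˡ (ℂ.trans (conj-* 𝕚 t) (ℂ.*-congʳ conj-𝕚)))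

      private
        product-hasSum : ∀ {s₁ s₂ s₃ s₄} →
          HasSum (λ π → ↑ (w π *ʳ ∣ f π + h π ∣²)) s₁ → HasSum (λ π → ↑ (w π *ʳ ∣ f π + 𝕚 * h π ∣²)) s₂ →
          HasSum (λ π → ↑ (w π *ʳ ∣ f π ∣²)) s₃ → HasSum (λ π → ↑ (w π *ʳ ∣ h π ∣²)) s₄ →
          HasSum (λ π → ↑ w π * (f π * conj (h π))) (↑ ½ * (s₁ + 𝕚 * s₂ + (- (↑ 1ʳ + 𝕚)) * (s₃ + s₄)))
        product-hasSum {f} {h} ⟶s₁ ⟶s₂ ⟶s₃ ⟶s₄ =
          hasSum-cong (λ π → z+z≈t⇒z≈½t (polarisation (w π) (f π) (h π)))
            (hasSum-* (↑ ½) (hasSum-+ (hasSum-+ ⟶s₁ (hasSum-* 𝕚 ⟶s₂)) (hasSum-* (- (↑ 1ʳ + 𝕚)) (hasSum-+ ⟶s₃ ⟶s₄))))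

      product-summable : SquareSummable f → SquareSummable h → Summable (λ π → ↑ w π * (f π * conj (h π)))
      product-summable {f} {h} f² h² = _ , product-hasSum {f} {h}
        (proj₂ (squareSummable-+ {f} {h} f² h²))
        (proj₂ (squareSummable-+ {f} {λ π → 𝕚 * h π} f² (squareSummable-* {h} 𝕚 h²)))
        (proj₂ f²) (proj₂ h²)

      mean-product : SquareSummable f → SquareSummable h → HasMean (λ π → f π * conj (h π)) (𝔼 (λ π → f π * conj (h π)))
      mean-product f² h² = summable⇒hasMean-𝔼 (product-summable f² h²)

      -- f is the product of f with the conjugate of the constant 1, and 1 is square-summable
      -- because the weights are summable.
      mean-squareSummable : SquareSummable f → HasMean f (𝔼 f)
      mean-squareSummable {f} f² = summable⇒hasMean-𝔼 (_ , hasSum-cong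
        (λ π → ℂ.*-congˡ (ℂ.trans (ℂ.*-congˡ (conj-real ℝ.refl)) (ℂ.*-identityʳ (f π))))
        (proj₂ (product-summable f² squareSummable-1)))

      squareMean-real : SquareSummable f → im (𝔼 (λ π → f π * conj (f π))) ≈ʳ 0ʳ
      squareMean-real {f} f² = mean-real (mean-cong (λ π → z*conj-z (f π)) (mean-product f² f²))

      -- The variance of f is nonnegative.
      ∣mean∣²≤squareMean : SquareSummable f → ∣ 𝔼 f ∣² ≤ re (𝔼 (λ π → f π * conj (f π)))
      ∣mean∣²≤squareMean {f} f² = ℝ.0≤y-x⇒x≤y (ℝ.≤-respʳ (proj₁ variance) (mean-nonneg
        (λ π → ∣∣²-nonneg (f π - μ))
        (mean-cong (λ π → expand (f π))
          (mean-+ (mean-+ (mean-+ (mean-product f² f²) (mean-* (- conj μ) f⟶μ)) (mean-* (- μ) (mean-conj f⟶μ)))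
                  (mean-* (μ * conj μ) mean-1)))))
        where
        open ℂ using (solve; _:=_; _:+_; _:-_; _:*_; :-_; con)
        μ q : ℂ
        μ = 𝔼 f
        q = 𝔼 (λ π → f π * conj (f π))
        f⟶μ : HasMean f μ
        f⟶μ = mean-squareSummable f²
        expand : ∀ z → z * conj z + - conj μ * z + - μ * conj z + μ * conj μ * ↑ 1ʳ ≈ ↑ ∣ z - μ ∣²
        expand z = ℂ.trans
          (solve 4 (λ z z̄ μ μ̄ → z :* z̄ :+ :- μ̄ :* z :+ :- μ :* z̄ :+ μ :* μ̄ :* con (+ 1) := (z :- μ) :* (z̄ :- μ̄))
            ℂ.refl z (conj z) μ (conj μ))
          (ℂ.trans (ℂ.*-congˡ (ℂ.sym (conj-- z μ))) (z*conj-z (z - μ)))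
        variance : q + - conj μ * μ + - μ * conj μ + μ * conj μ * ↑ 1ʳ ≈ q - ↑ ∣ μ ∣²
        variance = ℂ.trans
          (solve 3 (λ q μ μ̄ → q :+ :- μ̄ :* μ :+ :- μ :* μ̄ :+ μ :* μ̄ :* con (+ 1) := q :- μ :* μ̄)
            ℂ.refl q μ (conj μ))
          (ℂ.+-congˡ (ℂ.-‿cong (z*conj-z μ)))

      Ψ₂-real : ∀ K → SquareSummable (λ π → L π * K π) → im (Ψ₂ K K) ≈ʳ 0ʳ
      Ψ₂-real K = squareMean-real {λ π → L π * K π}

      ∣Ψ∣²≤Ψ₂ : ∀ K → SquareSummable (λ π → L π * K π) → ∣ Ψ K ∣² ≤ re (Ψ₂ K K)
      ∣Ψ∣²≤Ψ₂ K = ∣mean∣²≤squareMean {λ π → L π * K π}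

      β-quotient : ∀ K → SquareSummable (λ π → L π * K π) → 0ʳ < re (Ψ₂ K K) → β K *ʳ re (Ψ₂ K K) ≈ʳ ∣ Ψ K ∣²
      β-quotient K K² 0<re = guarded-quotient ∣ Ψ K ∣² (Ψ₂ K K) (Ψ₂-real K K²) 0<re (decide (Ψ₂ K K ≈ 0ℂ))

      -- Expansion of the means along M + α N

      module _ (M N : G → ℂ)
               (M² : SquareSummable (λ π → L π * M π)) (N² : SquareSummable (λ π → L π * N π)) where

        private
          LM LN : G → ℂ
          LM π = L π * M π
          LN π = L π * N π

          linear : ∀ α π → LM π + α * LN π ≈ L π * (M +[ α ] N) π
          linear α π = solve 4 (λ l m n α → l :* m :+ α :* (l :* n) := l :* (m :+ α :* n)) ℂ.refl (L π) (M π) (N π) α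
            where open ℂ using (solve; _:=_; _:+_; _:*_)

        squareSummable-pencil : ∀ α → SquareSummable (λ π → L π * (M +[ α ] N) π)
        squareSummable-pencil α = squareSummable-cong (linear α) (squareSummable-+ M² (squareSummable-* α N²))

        Ψ-pencil : ∀ α → Ψ (M +[ α ] N) ≈ Ψ M + α * Ψ N
        Ψ-pencil α = 𝔼≈ (mean-cong (linear α)
          (mean-+ (mean-squareSummable M²) (mean-* α (mean-squareSummable N²))))

        -- Sesquilinear expansion. The mean of L N times the conjugate of L M is obtained by
        -- conjugating `Ψ₂ M N`, so a single mixed moment C appears.
        Ψ₂-pencil : ∀ α → Ψ₂ (M +[ α ] N) (M +[ α ] N)
                          ≈ Ψ₂ M M + conj α * Ψ₂ M N + α * conj (Ψ₂ M N) + α * conj α * Ψ₂ N N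
        Ψ₂-pencil α = 𝔼≈ (mean-cong expand
          (mean-+ (mean-+ (mean-+ (mean-product M² M²) (mean-* (conj α) MN))
                          (mean-* α (mean-conj MN)))
                  (mean-* (α * conj α) (mean-product N² N²))))
          where
          MN : HasMean (λ π → LM π * conj (LN π)) (Ψ₂ M N)
          MN = mean-product M² N²
          open ℂ using (solve; _:=_; _:+_; _:*_)
          distribute : ∀ z t → z * conj z + conj α * (z * conj t) + α * conj (z * conj t) + α * conj α * (t * conj t)
                       ≈ (z + α * t) * conj (z + α * t)
          distribute z t = ℂ.trans
            (ℂ.+-congʳ (ℂ.+-congˡ (ℂ.*-congˡ (ℂ.trans (conj-* z (conj t)) (ℂ.*-congˡ (conj-involutive t))))))
            (ℂ.trans
              (solve 6 (λ z z̄ t t̄ α ᾱ →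
                z :* z̄ :+ ᾱ :* (z :* t̄) :+ α :* (z̄ :* t) :+ α :* ᾱ :* (t :* t̄)
                := (z :+ α :* t) :* (z̄ :+ ᾱ :* t̄)) ℂ.refl z (conj z) t (conj t) α (conj α))
              (ℂ.*-congˡ (ℂ.sym (ℂ.trans (conj-+ z (α * t)) (ℂ.+-congˡ (conj-* α t))))))
          expand : ∀ π → LM π * conj (LM π) + conj α * (LM π * conj (LN π)) + α * conj (LM π * conj (LN π))
                           + α * conj α * (LN π * conj (LN π))
                         ≈ (L π * (M +[ α ] N) π) * conj (L π * (M +[ α ] N) π)
          expand π = ℂ.trans (distribute (LM π) (LN π)) (ℂ.*-cong (linear α π) (conj-cong (linear α π)))

    -- R, em, G, L and w are the parameters of the enclosing modules.  With `let open`
    -- in the type instead, β (M +[ α₁ ] N) would contain fresh copies of all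
    -- operations, and comparing it with the lemmas would unfold it completely.
    theorem2p5 :
      (∀ π → 0ʳ ≤ w π) →
      ¬ (∀ π → w π ≈ʳ 0ʳ) →
      (M N : G → ℂ) →
      Summable (λ π → ↑ w π) →
      Summable (λ π → ↑ (w π *ʳ ∣ L π * M π ∣²)) →
      Summable (λ π → ↑ (w π *ʳ ∣ L π * N π ∣²)) →
      β N ≤ β M →
      ¬ (Ψ M * Ψ₂ N N ≈ 0ℂ) →
      (Ψ N * Ψ₂ M N ≈ Ψ M * Ψ₂ N N →
        ∀ α → ¬ (α ≈ - (Ψ M / Ψ N)) → β (M +[ α ] N) ≈ʳ β M)
      ×
      (¬ (Ψ N * Ψ₂ M N ≈ Ψ M * Ψ₂ N N) →
        let α₁ = (conj (Ψ M) * Ψ₂ M N - conj (Ψ N) * Ψ₂ M M)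
                 / (conj (Ψ N) * conj (Ψ₂ M N) - conj (Ψ M) * Ψ₂ N N)
            D  = Ψ₂ M M * Ψ₂ N N - ↑ ∣ Ψ₂ M N ∣²
            value₁ = (↑ ∣ Ψ N ∣² * Ψ₂ M M + ↑ ∣ Ψ M ∣² * Ψ₂ N N
                      - 2ℂ * ↑ re (conj (Ψ M) * Ψ N * Ψ₂ M N)) / D
            value₂ = ↑ β M + ↑ ∣ conj (Ψ M) * Ψ₂ M N - conj (Ψ N) * Ψ₂ M M ∣²
                             / (Ψ₂ M M * D)
        in (∀ α → β (M +[ α ] N) ≤ β (M +[ α₁ ] N))
           × (↑ β (M +[ α₁ ] N) ≈ value₁)
           × (value₁ ≈ value₂)
           × Positive D
           × Positive (Ψ₂ M M * D))
    theorem2p5 0≤w w≢0 M N w-summable M² N² βN≤βM ΨMΨ₂NN≉0 =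
      degenerate-case quotientData ΨMΨ₂NN≉0 βN≤βM , nondegenerate-case quotientData ΨMΨ₂NN≉0
      where
      open WeightedMean 0≤w w≢0 w-summable
      pencil² : ∀ α → SquareSummable (λ π → L π * (M +[ α ] N) π)
      pencil² = squareSummable-pencil M N M² N²
      quotientData :
        let num = conj (Ψ M) * Ψ₂ M N - conj (Ψ N) * Ψ₂ M M
            den = conj (Ψ N) * conj (Ψ₂ M N) - conj (Ψ M) * Ψ₂ N N
            V   = ↑ ∣ Ψ N ∣² * Ψ₂ M M + ↑ ∣ Ψ M ∣² * Ψ₂ N N - 2ℂ * ↑ re (conj (Ψ M) * Ψ N * Ψ₂ M N)
            D   = Ψ₂ M M * Ψ₂ N N - ↑ ∣ Ψ₂ M N ∣²
        in QuotientData (Ψ M) (Ψ N) (Ψ₂ M M) (Ψ₂ N N) (Ψ₂ M N)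
             (λ α → Ψ (M +[ α ] N)) (λ α → Ψ₂ (M +[ α ] N) (M +[ α ] N)) (β M) (β N) (λ α → β (M +[ α ] N))
             num den V D (num / den)
      quotientData = record
        { num≡   = ≡.refl
        ; den≡   = ≡.refl
        ; V≡     = ≡.refl
        ; D≡     = ≡.refl
        ; α₁≡    = ≡.refl
        ; A-real = Ψ₂-real M M²
        ; B-real = Ψ₂-real N N²
        ; Q-real = λ α → Ψ₂-real (M +[ α ] N) (pencil² α)
        ; P≈     = Ψ-pencil M N M² N²
        ; Q≈     = Ψ₂-pencil M N M² N²
        ; ∣p∣²≤A = ∣Ψ∣²≤Ψ₂ M M²
        ; ∣q∣²≤B = ∣Ψ∣²≤Ψ₂ N N²
        ; ∣P∣²≤Q = λ α → ∣Ψ∣²≤Ψ₂ (M +[ α ] N) (pencil² α)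
        ; βM*A   = β-quotient M M²
        ; βN*B   = β-quotient N N²
        ; β*Q    = λ α → β-quotient (M +[ α ] N) (pencil² α)
        }
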